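{- Let $\alpha,\beta\ge 1$ be real numbers. For every $X>1$, the numbers of elliptic curves in the families $\mathcal{E}(X;H_{\alpha,\beta})$ and $\widetilde{\mathcal{E}}(X;H_{\alpha,\beta})$ satisfy $$\#\mathcal{E}(X;H_{\alpha,\beta})=\frac{4}{\alpha^{1/3}\beta^{1/2}\zeta(10)}X^{5/6}+O(X^{1/2})$$ and $$\#\widetilde{\mathcal{E}}(X;H_{\alpha,\beta})=\left(2\left\lfloor\frac{X^{1/3}}{\alpha^{1/3}}\right\rfloor+1\right)\left(2\left\lfloor\frac{X^{1/2}}{\beta^{1/2}}\right\rfloor+1\right)-2\left\lfloor c(\alpha,\beta)X^{1/6}\right\rfloor-1=\frac{4}{\alpha^{1/3}\beta^{1/2}}X^{5/6}+O(X^{1/2}),$$ where $$c(\alpha,\beta):=\min\left\{\frac{1}{3^{1/2}\alpha^{1/6}},\frac{1}{2^{1/3}\beta^{1/6}}\right\}.$$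
   Context: For $(A,B)\in\mathbb{Z}^2$ let $E_{A,B}$ denote the curve $y^2=x^3+Ax+B$; curves are counted by their pairs $(A,B)$. Let $\widetilde{\mathcal{E}}$ be the set of all $E_{A,B}$ with $A,B\in\mathbb{Z}$ and $\Delta_{E_{A,B}}:=-16(4A^3+27B^2)\neq 0$. Let $\mathcal{E}$ be the set of $E_{A,B}\in\widetilde{\mathcal{E}}$ such that there is no prime $p$ with $p^4\mid A$ and $p^6\mid B$. For real $\alpha,\beta\ge1$ the generalized naive height is $H_{\alpha,\beta}(E_{A,B}):=\max\{\alpha|A|^3,\beta B^2\}$. For $X>0$ and a family $\mathcal{F}$, $\mathcal{F}(X;H_{\alpha,\beta}):=\{E_{A,B}\in\mathcal{F} : H_{\alpha,\beta}(E_{A,B})\le X\}$. $\zeta$ is the Riemann zeta function. The parameters $\alpha,\beta$ are fixed; implied constants in $O(\cdot)$ may depend on them. -}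

module Defs where

open import Level using (0ℓ)
open import Axiom.ExcludedMiddle using (ExcludedMiddle)
open import Algebra.Bundles using (CommutativeRing)
open import Algebra.Structures using (IsCommutativeRing)
import Algebra.Construct.NaturalChoice.Max as Max
import Algebra.Construct.NaturalChoice.Min as Min
import Algebra.Properties.Ring as RingProperties
import Algebra.Properties.Semiring.Exp as Exp
import Algebra.Properties.Semiring.Mult as Mult
open import Data.Empty using (⊥-elim)
open import Data.Integer.Base as ℤ using (ℤ; +_; -[1+_])
import Data.Integer.Divisibility as ℤ
import Data.Integer.Properties as ℤ
open import Data.List.Base using (List; length; filter; deduplicate; map; upTo; _++_; cartesianProduct)
open import Data.List.Membership.Propositional using (_∈_)
open import Data.List.Membership.Propositional.Properties
  using (∈-map⁺; ∈-upTo⁺; ∈-++⁺ˡ; ∈-++⁺ʳ; ∈-cartesianProduct⁺)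
open import Data.Nat.Base as ℕ using (ℕ; zero; suc; NonZero)
open import Data.Nat.Primality using (Prime)
import Data.Nat.Properties as ℕ
open import Data.Product.Base using (Σ; ∃; ∃-syntax; _×_; _,_; proj₁; proj₂)
open import Data.Product.Properties using (≡-dec)
open import Data.Sum.Base using (_⊎_; inj₁; inj₂)
open import Function.Base using (_∘_)
open import Relation.Binary.Bundles using (TotalOrder)
import Relation.Binary.Construct.NonStrictToStrict as Strict
open import Relation.Binary.PropositionalEquality as ≡ using (_≡_; _≢_)
import Relation.Binary.Reasoning.Setoid as SetoidReasoning
open import Relation.Binary.Structures using (IsTotalOrder)
open import Relation.Nullary using (¬_; Dec; yes; no)
open import Relation.Nullary.Decidable using (True; toWitness)
open import Relation.Unary using (Pred)

-- The real numbers enter as an arbitrary Dedekind-complete ordered field,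
-- which is unique up to isomorphism.  Nothing is assumed about the
-- inverse of zero.

record CompleteOrderedField : Set₁ where
  infix  4 _≈_ _≤_
  infixl 6 _+_
  infixl 7 _*_
  infix  8 -_
  infix  9 _⁻¹
  field
    Carrier           : Set
    _≈_ _≤_           : Carrier → Carrier → Set
    _+_ _*_           : Carrier → Carrier → Carrier
    -_ _⁻¹            : Carrier → Carrier
    0# 1#             : Carrier
    isCommutativeRing : IsCommutativeRing _≈_ _+_ _*_ -_ 0# 1#
    isTotalOrder      : IsTotalOrder _≈_ _≤_
    0≉1               : ¬ 0# ≈ 1#
    ⁻¹-inverseʳ       : ∀ x → ¬ x ≈ 0# → x * x ⁻¹ ≈ 1#
    +-monoˡ-≤         : ∀ z {x y} → x ≤ y → x + z ≤ y + z
    *-nonneg          : ∀ {x y} → 0# ≤ x → 0# ≤ y → 0# ≤ x * y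

  UpperBound : (Carrier → Set) → Carrier → Set
  UpperBound P u = ∀ x → P x → x ≤ u

  field
    supremum : ∀ P → ∃ P → ∃ (UpperBound P) →
               ∃[ s ] UpperBound P s × (∀ u → UpperBound P u → s ≤ u)

  commutativeRing : CommutativeRing 0ℓ 0ℓ
  commutativeRing = record { isCommutativeRing = isCommutativeRing }

  totalOrder : TotalOrder 0ℓ 0ℓ 0ℓ
  totalOrder = record { isTotalOrder = isTotalOrder }

-- Excluded middle makes the order on the reals decidable; floors and
-- counts at real arguments depend on it.

module Reals (em : ExcludedMiddle 0ℓ) (ℝ : CompleteOrderedField) where

  open CompleteOrderedField ℝ public
    using (Carrier; _≈_; _≤_; _+_; _*_; -_; _⁻¹; 0#; 1#; commutativeRing; totalOrder)
  open CompleteOrderedField ℝ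
    using (isTotalOrder; 0≉1; ⁻¹-inverseʳ; +-monoˡ-≤; *-nonneg; UpperBound; supremum)
  open CommutativeRing commutativeRing public using (_-_)
  open Exp (CommutativeRing.semiring commutativeRing) public using (_^_)
  open Max totalOrder public using (_⊔_)
  open Min totalOrder public using (_⊓_)
  open Strict _≈_ _≤_ public using (_<_)

  infixl 7 _/_
  _/_ : Carrier → Carrier → Carrier
  x / y = x * y ⁻¹

  ∣_∣ : Carrier → Carrier
  ∣ x ∣ = x ⊔ (- x)

  fromℕ : ℕ → Carrier
  fromℕ n = Mult._×_ (CommutativeRing.semiring commutativeRing) n 1#

  fromℤ : ℤ → Carrier
  fromℤ (+ n)    = fromℕ n
  fromℤ -[1+ n ] = - fromℕ (suc n)

  ∑<_ : ℕ → (ℕ → Carrier) → Carrier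
  (∑< zero)  f = 0#
  (∑< suc n) f = (∑< n) f + f n

  _⟶_ : (ℕ → Carrier) → Carrier → Set
  a ⟶ l = ∀ ε → 0# < ε → ∃[ N ] (∀ n → N ℕ.≤ n → ∣ a n - l ∣ < ε)

  module Lemmas where
    module R  = CommutativeRing commutativeRing
    module RP = RingProperties R.ring
    module O  = IsTotalOrder isTotalOrder
    module E  = Exp R.semiring
    module MX = Max totalOrder
    open SetoidReasoning R.setoid

    ≤-resp : ∀ {x x′ y y′} → x ≈ x′ → y ≈ y′ → x ≤ y → x′ ≤ y′
    ≤-resp p q h = O.≤-respʳ-≈ q (O.≤-respˡ-≈ p h)

    ≮⇒≥ : ∀ {x y} → ¬ x < y → y ≤ x
    ≮⇒≥ = Strict.≮⇒≥ _≈_ _≤_ R.sym (λ _ _ → em) O.reflexive O.total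

    <⇒≱ : ∀ {x y} → x < y → ¬ y ≤ x
    <⇒≱ = Strict.<⇒≱ _≈_ _≤_ O.antisym

    ≤-<-trans : ∀ {x y z} → x ≤ y → y < z → x < z
    ≤-<-trans = Strict.≤-<-trans _≈_ _≤_ O.trans O.antisym O.≤-respˡ-≈

    +-monoʳ-≤ : ∀ z {x y} → x ≤ y → z + x ≤ z + y
    +-monoʳ-≤ z h = ≤-resp (R.+-comm _ z) (R.+-comm _ z) (+-monoˡ-≤ z h)

    +-cancelʳ : ∀ x y → (x + y) - y ≈ x
    +-cancelʳ x y = begin
      (x + y) + - y  ≈⟨ R.+-assoc x y (- y) ⟩
      x + (y + - y)  ≈⟨ R.+-congˡ (R.-‿inverseʳ y) ⟩
      x + 0#         ≈⟨ R.+-identityʳ x ⟩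
      x              ∎

    -+-cancel : ∀ x y → (x - y) + y ≈ x
    -+-cancel x y = begin
      (x + - y) + y  ≈⟨ R.+-assoc x (- y) y ⟩
      x + (- y + y)  ≈⟨ R.+-congˡ (R.-‿inverseˡ y) ⟩
      x + 0#         ≈⟨ R.+-identityʳ x ⟩
      x              ∎

    x≤y-z⇒x+z≤y : ∀ {x y z} → x ≤ y - z → x + z ≤ y
    x≤y-z⇒x+z≤y {x} {y} {z} h = ≤-resp R.refl (-+-cancel y z) (+-monoˡ-≤ z h)

    x+z≤y⇒x≤y-z : ∀ {x y z} → x + z ≤ y → x ≤ y - z
    x+z≤y⇒x≤y-z {x} {y} {z} h = ≤-resp (+-cancelʳ x z) R.refl (+-monoˡ-≤ (- z) h)

    0≤y-x : ∀ {x y} → x ≤ y → 0# ≤ y - x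
    0≤y-x {x} h = ≤-resp (R.-‿inverseʳ x) R.refl (+-monoˡ-≤ (- x) h)

    0≤y-x⇒x≤y : ∀ {x y} → 0# ≤ y - x → x ≤ y
    0≤y-x⇒x≤y {x} h = ≤-resp (R.+-identityˡ x) R.refl (x≤y-z⇒x+z≤y h)

    neg-≤ : ∀ {x y} → x ≤ y → - y ≤ - x
    neg-≤ {x} {y} h = 0≤y-x⇒x≤y (≤-resp R.refl eq (0≤y-x h))
      where
      eq : y - x ≈ - x - - y
      eq = begin
        y + - x      ≈⟨ R.+-comm y (- x) ⟩
        - x + y      ≈⟨ R.+-congˡ (RP.-‿involutive y) ⟨
        - x + - - y  ∎

    *-monoˡ-≤ : ∀ {z x y} → 0# ≤ z → x ≤ y → z * x ≤ z * y
    *-monoˡ-≤ {z} {x} {y} 0≤z h = 0≤y-x⇒x≤y (≤-resp R.refl eq (*-nonneg 0≤z (0≤y-x h)))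
      where
      eq : z * (y - x) ≈ z * y - z * x
      eq = begin
        z * (y + - x)      ≈⟨ R.distribˡ z y (- x) ⟩
        z * y + z * - x    ≈⟨ R.+-congˡ (RP.-‿distribʳ-* z x) ⟨
        z * y + - (z * x)  ∎

    0≤1 : 0# ≤ 1#
    0≤1 with O.total 0# 1#
    ... | inj₁ h = h
    ... | inj₂ h = ≤-resp R.refl eq (*-nonneg 0≤-1 0≤-1)
      where
      0≤-1 : 0# ≤ - 1#
      0≤-1 = ≤-resp RP.-0#≈0# R.refl (neg-≤ h)
      eq : - 1# * - 1# ≈ 1#
      eq = begin
        - 1# * - 1#    ≈⟨ RP.-‿distribˡ-* 1# (- 1#) ⟨
        - (1# * - 1#)  ≈⟨ R.-‿cong (R.*-identityˡ (- 1#)) ⟩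
        - - 1#         ≈⟨ RP.-‿involutive 1# ⟩
        1#             ∎

    1≰0 : ¬ 1# ≤ 0#
    1≰0 h = 0≉1 (O.antisym 0≤1 h)

    x+1≰x : ∀ {x} → ¬ x + 1# ≤ x
    x+1≰x {x} h = 1≰0 (≤-resp eq (R.-‿inverseʳ x) (+-monoˡ-≤ (- x) h))
      where
      eq : (x + 1#) - x ≈ 1#
      eq = R.trans (R.+-congʳ (R.+-comm x 1#)) (+-cancelʳ 1# x)

    x≤x+1 : ∀ {x} → x ≤ x + 1#
    x≤x+1 {x} = ≤-resp (R.+-identityʳ x) R.refl (+-monoʳ-≤ x 0≤1)

    ^-nonneg : ∀ {x} n → 0# ≤ x → 0# ≤ x ^ n
    ^-nonneg zero    h = 0≤1
    ^-nonneg (suc n) h = *-nonneg h (^-nonneg n h)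

    1≤^ : ∀ {x} n → 1# ≤ x → 1# ≤ x ^ n
    1≤^ zero    h = O.refl
    1≤^ {x} (suc n) h =
      O.trans h (≤-resp (R.*-identityʳ x) R.refl (*-monoˡ-≤ (O.trans 0≤1 h) (1≤^ n h)))

    ^≤1 : ∀ {x} n → 0# ≤ x → x ≤ 1# → x ^ n ≤ 1#
    ^≤1 zero    0≤x h = O.refl
    ^≤1 {x} (suc n) 0≤x h =
      O.trans (≤-resp R.refl (R.*-identityʳ x) (*-monoˡ-≤ 0≤x (^≤1 n 0≤x h))) h

    x≤x^n : ∀ {x} n .{{_ : NonZero n}} → 1# ≤ x → x ≤ x ^ n
    x≤x^n {x} (suc n) h =
      ≤-resp (R.*-identityʳ x) R.refl (*-monoˡ-≤ (O.trans 0≤1 h) (1≤^ n h))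

    ^-distrib-* : ∀ x y n → (x * y) ^ n ≈ x ^ n * y ^ n
    ^-distrib-* x y zero    = R.sym (R.*-identityˡ 1#)
    ^-distrib-* x y (suc n) = begin
      (x * y) * (x * y) ^ n      ≈⟨ R.*-congˡ (^-distrib-* x y n) ⟩
      (x * y) * (x ^ n * y ^ n)  ≈⟨ R.*-assoc x y _ ⟩
      x * (y * (x ^ n * y ^ n))  ≈⟨ R.*-congˡ (R.*-assoc y _ _) ⟨
      x * ((y * x ^ n) * y ^ n)  ≈⟨ R.*-congˡ (R.*-congʳ (R.*-comm y _)) ⟩
      x * ((x ^ n * y) * y ^ n)  ≈⟨ R.*-congˡ (R.*-assoc _ y _) ⟩
      x * (x ^ n * (y * y ^ n))  ≈⟨ R.*-assoc x _ _ ⟨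
      (x * x ^ n) * (y * y ^ n)  ∎

    1^n : ∀ n → 1# ^ n ≈ 1#
    1^n zero    = R.refl
    1^n (suc n) = R.trans (R.*-identityˡ _) (1^n n)

    0≤fromℕ : ∀ n → 0# ≤ fromℕ n
    0≤fromℕ zero    = O.refl
    0≤fromℕ (suc n) =
      O.trans (0≤fromℕ n) (≤-resp R.refl (R.+-comm _ 1#) x≤x+1)

    1≤fromℕ : ∀ n → 1# ≤ fromℕ (suc n)
    1≤fromℕ n = ≤-resp (R.+-identityʳ 1#) R.refl (+-monoʳ-≤ 1# (0≤fromℕ n))

    fromℕ-mono : ∀ {m n} → m ℕ.≤ n → fromℕ m ≤ fromℕ n
    fromℕ-mono {n = n} ℕ.z≤n = 0≤fromℕ n
    fromℕ-mono (ℕ.s≤s h)     = +-monoʳ-≤ 1# (fromℕ-mono h)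

    module Inv (n : ℕ) where
      N : Carrier
      N = fromℕ (suc n)

      N≉0 : ¬ N ≈ 0#
      N≉0 eq = 1≰0 (≤-resp R.refl eq (1≤fromℕ n))

      inverse : N * N ⁻¹ ≈ 1#
      inverse = ⁻¹-inverseʳ N N≉0

      0≤N⁻¹ : 0# ≤ N ⁻¹
      0≤N⁻¹ with O.total 0# (N ⁻¹)
      ... | inj₁ h = h
      ... | inj₂ h =
        ⊥-elim (1≰0 (≤-resp inverse (R.zeroʳ N) (*-monoˡ-≤ (0≤fromℕ (suc n)) h)))

      N⁻¹≤1 : N ⁻¹ ≤ 1#
      N⁻¹≤1 = ≤-resp (R.*-identityʳ _) (R.trans (R.*-comm _ N) inverse)
                (*-monoˡ-≤ 0≤N⁻¹ (1≤fromℕ n))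

      ^-inverse : ∀ s → N ^ s * (N ⁻¹) ^ s ≈ 1#
      ^-inverse s = begin
        N ^ s * (N ⁻¹) ^ s  ≈⟨ ^-distrib-* N (N ⁻¹) s ⟨
        (N * N ⁻¹) ^ s      ≈⟨ E.^-congˡ s inverse ⟩
        1# ^ s              ≈⟨ 1^n s ⟩
        1#                  ∎

      ^-⁻¹ : ∀ s → (N ^ s) ⁻¹ ≈ (N ⁻¹) ^ s
      ^-⁻¹ s = begin
        t                             ≈⟨ R.*-identityʳ t ⟨
        t * 1#                        ≈⟨ R.*-congˡ (^-inverse s) ⟨
        t * (N ^ s * (N ⁻¹) ^ s)      ≈⟨ R.*-assoc t _ _ ⟨
        (t * N ^ s) * (N ⁻¹) ^ s      ≈⟨ R.*-congʳ (R.*-comm t _) ⟩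
        (N ^ s * t) * (N ⁻¹) ^ s      ≈⟨ R.*-congʳ (⁻¹-inverseʳ (N ^ s) N^s≉0) ⟩
        1# * (N ⁻¹) ^ s               ≈⟨ R.*-identityˡ _ ⟩
        (N ⁻¹) ^ s                    ∎
        where
        t = (N ^ s) ⁻¹
        N^s≉0 : ¬ N ^ s ≈ 0#
        N^s≉0 eq = 1≰0 (≤-resp R.refl eq (1≤^ s (1≤fromℕ n)))

      0≤term : ∀ s → 0# ≤ (N ^ s) ⁻¹
      0≤term s = ≤-resp R.refl (R.sym (^-⁻¹ s)) (^-nonneg s 0≤N⁻¹)

  open Lemmas

  archimedean : ∀ x → ∃[ n ] x < fromℕ n
  archimedean x with em {P = ∃[ n ] x < fromℕ n}
  ... | yes h = h
  ... | no ∄n = ⊥-elim (x+1≰x (x≤y-z⇒x+z≤y (least (s - 1#) s-1-bound)))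
    where
    IsNat : Carrier → Set
    IsNat y = ∃[ n ] y ≈ fromℕ n
    sup   = supremum IsNat (0# , 0 , R.refl)
              (x , λ { y (n , eq) → O.≤-respˡ-≈ (R.sym eq) (≮⇒≥ (λ h → ∄n (n , h))) })
    s     = proj₁ sup
    upper = proj₁ (proj₂ sup)
    least = proj₂ (proj₂ sup)
    s-1-bound : UpperBound IsNat (s - 1#)
    s-1-bound y (n , eq) = x+z≤y⇒x≤y-z
      (upper (y + 1#) (suc n , R.trans (R.+-comm y 1#) (R.+-congˡ eq)))

  floor-exists : ∀ x → ∃[ n ] fromℤ n ≤ x × x < fromℤ (ℤ.suc n)
  floor-exists x with archimedean x | archimedean (- x)
  ... | n , x<n | m , -x<m =
    search (m ℕ.+ n) (ℤ.- + m) (lower m (proj₁ -x<m))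
      (≡.subst (λ i → x < fromℤ i) (≡.sym sum≡) x<n)
    where
    lower : ∀ m → - x ≤ fromℕ m → fromℤ (ℤ.- + m) ≤ x
    lower zero    h = ≤-resp RP.-0#≈0# (RP.-‿involutive x) (neg-≤ h)
    lower (suc m) h = ≤-resp R.refl (RP.-‿involutive x) (neg-≤ h)

    sum≡ : ℤ.- + m ℤ.+ + (m ℕ.+ n) ≡ + n
    sum≡ = ≡.trans (≡.cong (ℤ._+_ (ℤ.- + m)) (ℤ.pos-+ m n))
          (≡.trans (≡.sym (ℤ.+-assoc (ℤ.- + m) (+ m) (+ n)))
          (≡.trans (≡.cong (ℤ._+ + n) (ℤ.+-inverseˡ (+ m))) (ℤ.+-identityˡ (+ n))))

    shift : ∀ a k → a ℤ.+ + suc k ≡ ℤ.suc a ℤ.+ + k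
    shift a k = ≡.trans (≡.sym (ℤ.+-assoc a (+ 1) (+ k))) (≡.cong (ℤ._+ + k) (ℤ.+-comm a (+ 1)))

    search : ∀ k a → fromℤ a ≤ x → x < fromℤ (a ℤ.+ + k) →
             ∃[ n ] fromℤ n ≤ x × x < fromℤ (ℤ.suc n)
    search zero a a≤x x<a =
      ⊥-elim (<⇒≱ (≡.subst (λ i → x < fromℤ i) (ℤ.+-identityʳ a) x<a) a≤x)
    search (suc k) a a≤x x<a+k with em {P = x < fromℤ (ℤ.suc a)}
    ... | yes h = a , a≤x , h
    ... | no  h = search k (ℤ.suc a) (≮⇒≥ h) (≡.subst (λ i → x < fromℤ i) (shift a k) x<a+k)

  ⌊_⌋ : Carrier → ℤ
  ⌊ x ⌋ = proj₁ (floor-exists x)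

  -- The disjunct y ≈ 0# only matters for x < 0, where it makes the
  -- root 0.

  RootCandidate : ℕ → Carrier → Carrier → Set
  RootCandidate n x y = y ≈ 0# ⊎ (0# ≤ y × y ^ n ≤ x)

  rootCandidate-bounded : ∀ n .{{_ : NonZero n}} x → UpperBound (RootCandidate n x) (1# ⊔ x)
  rootCandidate-bounded n x y (inj₁ y≈0) = O.trans (O.reflexive y≈0) (O.trans 0≤1 (MX.x≤x⊔y 1# x))
  rootCandidate-bounded n x y (inj₂ (0≤y , y^n≤x)) with O.total y 1#
  ... | inj₁ y≤1 = O.trans y≤1 (MX.x≤x⊔y 1# x)
  ... | inj₂ 1≤y = O.trans (x≤x^n n 1≤y) (O.trans y^n≤x (MX.x≤y⊔x 1# x))

  root : ∀ n .{{_ : NonZero n}} → Carrier → Carrier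
  root n x = proj₁ (supremum (RootCandidate n x) (0# , inj₁ R.refl)
                     (1# ⊔ x , rootCandidate-bounded n x))

  infix 9 _^[_/_]
  _^[_/_] : Carrier → ℕ → ∀ n .{{_ : NonZero n}} → Carrier
  x ^[ m / n ] = root n x ^ m

  ζ-term : ℕ → ℕ → Carrier
  ζ-term s n = (fromℕ (suc n) ^ s) ⁻¹

  module ζ-Convergence (k : ℕ) where
    open SetoidReasoning R.setoid

    s : ℕ
    s = suc (suc k)

    S : ℕ → Carrier
    S N = (∑< N) (ζ-term s)

    term-bound : ∀ n → ζ-term s (suc n) + fromℕ (suc (suc n)) ⁻¹ ≤ fromℕ (suc n) ⁻¹
    term-bound n =
      ≤-resp R.refl (R.trans (R.+-comm _ b) (R.sym a≈b+ab)) (+-monoˡ-≤ b t≤ab)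
      where
      module A = Inv n
      module B = Inv (suc n)
      a = A.N ⁻¹
      b = B.N ⁻¹
      a≈b+ab : a ≈ b + a * b
      a≈b+ab = begin
        a                            ≈⟨ R.*-identityʳ a ⟨
        a * 1#                       ≈⟨ R.*-congˡ B.inverse ⟨
        a * ((1# + A.N) * b)         ≈⟨ R.*-congˡ (R.distribʳ b 1# A.N) ⟩
        a * (1# * b + A.N * b)       ≈⟨ R.*-congˡ (R.+-congʳ (R.*-identityˡ b)) ⟩
        a * (b + A.N * b)            ≈⟨ R.distribˡ a b _ ⟩
        a * b + a * (A.N * b)        ≈⟨ R.+-congˡ (R.*-assoc a A.N b) ⟨
        a * b + (a * A.N) * b        ≈⟨ R.+-congˡ (R.*-congʳ (R.*-comm a A.N)) ⟩
        a * b + (A.N * a) * b        ≈⟨ R.+-congˡ (R.*-congʳ A.inverse) ⟩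
        a * b + 1# * b               ≈⟨ R.+-congˡ (R.*-identityˡ b) ⟩
        a * b + b                    ≈⟨ R.+-comm _ b ⟩
        b + a * b                    ∎
      b≤a : b ≤ a
      b≤a = ≤-resp (R.+-identityʳ b) (R.sym a≈b+ab)
              (+-monoʳ-≤ b (*-nonneg A.0≤N⁻¹ B.0≤N⁻¹))
      b^s≤bb : b ^ s ≤ b * b
      b^s≤bb = *-monoˡ-≤ B.0≤N⁻¹ (≤-resp R.refl (R.*-identityʳ b)
                 (*-monoˡ-≤ B.0≤N⁻¹ (^≤1 k B.0≤N⁻¹ B.N⁻¹≤1)))
      t≤ab : ζ-term s (suc n) ≤ a * b
      t≤ab = ≤-resp (R.sym (B.^-⁻¹ s)) (R.*-comm b a)
               (O.trans b^s≤bb (*-monoˡ-≤ B.0≤N⁻¹ b≤a))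

    bound : ∀ n → S (suc n) + fromℕ (suc n) ⁻¹ ≤ 1# + 1#
    bound zero = ≤-resp R.refl R.refl (O.trans
      (+-monoˡ-≤ _ (≤-resp (R.sym (R.trans (R.+-identityˡ _) (Inv.^-⁻¹ 0 s))) R.refl
                            (^≤1 s (Inv.0≤N⁻¹ 0) (Inv.N⁻¹≤1 0))))
      (+-monoʳ-≤ 1# (Inv.N⁻¹≤1 0)))
    bound (suc n) = O.trans
      (≤-resp (R.sym (R.+-assoc _ _ _)) R.refl (+-monoʳ-≤ (S (suc n)) (term-bound n)))
      (bound n)

    S-step : ∀ n → S n ≤ S (suc n)
    S-step n = ≤-resp (R.+-identityʳ _) R.refl (+-monoʳ-≤ (S n) (Inv.0≤term n s))

    S-mono : ∀ {m n} → m ℕ.≤ n → S m ≤ S n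
    S-mono {m} {n} h = go (ℕ.≤⇒≤′ h)
      where
      go : ∀ {n} → m ℕ.≤′ n → S m ≤ S n
      go (ℕ.≤′-reflexive ≡.refl) = O.refl
      go (ℕ.≤′-step {n} h)       = O.trans (go h) (S-step n)

    S≤2 : ∀ n → S n ≤ 1# + 1#
    S≤2 n = O.trans (S-step n)
      (O.trans (≤-resp (R.+-identityʳ _) R.refl (+-monoʳ-≤ _ (Inv.0≤N⁻¹ n))) (bound n))

    IsPartialSum : Carrier → Set
    IsPartialSum x = ∃[ n ] x ≈ S n

    sup   = supremum IsPartialSum (S 0 , 0 , R.refl)
              (1# + 1# , λ { x (n , eq) → O.≤-respˡ-≈ (R.sym eq) (S≤2 n) })
    z     = proj₁ sup
    S≤z   = λ n → proj₁ (proj₂ sup) (S n) (n , R.refl)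
    least = proj₂ (proj₂ sup)

    limit : S ⟶ z
    limit ε 0<ε with em {P = ∃[ N ] z - ε < S N}
    ... | no ∄N = ⊥-elim (<⇒≱ 0<ε ε≤0)
      where
      z+ε≤z : z + ε ≤ z
      z+ε≤z = x≤y-z⇒x+z≤y (least (z - ε)
        (λ { x (n , eq) → O.≤-respˡ-≈ (R.sym eq) (≮⇒≥ (λ h → ∄N (n , h))) }))
      ε≤0 : ε ≤ 0#
      ε≤0 = ≤-resp (R.trans (R.+-congʳ (R.+-comm z ε)) (+-cancelʳ ε z)) (R.-‿inverseʳ z)
              (+-monoˡ-≤ (- z) z+ε≤z)
    ... | yes (N , z-ε<SN) = N , close
      where
      close : ∀ n → N ℕ.≤ n → ∣ S n - z ∣ < ε
      close n N≤n = ≤-<-trans (MX.⊔-lub S-z≤z-S -S-z≤z-S) z-S<ε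
        where
        0≤z-S : 0# ≤ z - S n
        0≤z-S = 0≤y-x (S≤z n)
        -[S-z]≈z-S : - (S n - z) ≈ z - S n
        -[S-z]≈z-S = begin
          - (S n + - z)    ≈⟨ RP.-‿+-comm (S n) (- z) ⟨
          - S n + - - z    ≈⟨ R.+-congˡ (RP.-‿involutive z) ⟩
          - S n + z        ≈⟨ R.+-comm _ z ⟩
          z + - S n        ∎
        -S-z≤z-S : - (S n - z) ≤ z - S n
        -S-z≤z-S = O.reflexive -[S-z]≈z-S
        S-z≤z-S : S n - z ≤ z - S n
        S-z≤z-S = O.trans (≤-resp R.refl (R.-‿inverseʳ z) (+-monoˡ-≤ (- z) (S≤z n))) 0≤z-S
        z-S<ε : z - S n < ε
        z-S<ε = Strict.≰⇒> _≈_ _≤_ R.sym O.reflexive O.total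
          (λ ε≤z-S → <⇒≱ z-ε<SN (O.trans (S-mono N≤n) (S≤z-ε ε≤z-S)))
          where
          S≤z-ε : ε ≤ z - S n → S n ≤ z - ε
          S≤z-ε h = x+z≤y⇒x≤y-z (≤-resp (R.+-comm ε (S n)) R.refl (x≤y-z⇒x+z≤y h))

  ζ-converges : ∀ s → 2 ℕ.≤ s → ∃[ z ] (λ N → (∑< N) (ζ-term s)) ⟶ z
  ζ-converges (suc zero)    (ℕ.s≤s ())
  ζ-converges (suc (suc k)) _ = ζ-Convergence.z k , ζ-Convergence.limit k

  -- The Riemann zeta function at integers s ≥ 2, as the sum of its
  -- Dirichlet series.

  ζ : ∀ s {2≤s : True (2 ℕ.≤? s)} → Carrier
  ζ s {2≤s} = proj₁ (ζ-converges s (toWitness 2≤s))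

  -- f X = g X + O(h X), uniformly for all X > 1.

  infix 4 _≈_+O_
  _≈_+O_ : (f g h : Carrier → Carrier) → Set
  f ≈ g +O h = ∃[ C ] (∀ X → 1# < X → ∣ f X - g X ∣ ≤ C * h X)

-- The pair (A , B) stands for the curve y² = x³ + A x + B.

Curve : Set
Curve = ℤ × ℤ

Δ : Curve → ℤ
Δ (A , B) = ℤ.- (+ 16) ℤ.* (+ 4 ℤ.* A ℤ.^ 3 ℤ.+ + 27 ℤ.* B ℤ.^ 2)

ℰ̃ : Pred Curve 0ℓ
ℰ̃ E = Δ E ≢ + 0

ℰ : Pred Curve 0ℓ
ℰ E@(A , B) = ℰ̃ E × ¬ (∃[ p ] Prime p × + (p ℕ.^ 4) ℤ.∣ A × + (p ℕ.^ 6) ℤ.∣ B)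

Finite : Pred Curve 0ℓ → Set
Finite P = ∃[ Es ] (∀ E → P E → E ∈ Es)

module Counting
  (em : ExcludedMiddle 0ℓ) (ℝ : CompleteOrderedField)
  (α β : CompleteOrderedField.Carrier ℝ)
  (1≤α : CompleteOrderedField._≤_ ℝ (CompleteOrderedField.1# ℝ) α)
  (1≤β : CompleteOrderedField._≤_ ℝ (CompleteOrderedField.1# ℝ) β) where

  open Reals em ℝ

  H : Curve → Carrier
  H (A , B) = (α * fromℕ (ℤ.∣ A ∣ ℕ.^ 3)) ⊔ (β * fromℤ (B ℤ.^ 2))

  infix 10 _⟨_⟩
  _⟨_⟩ : Pred Curve 0ℓ → Carrier → Pred Curve 0ℓ
  (𝓕 ⟨ X ⟩) E = 𝓕 E × H E ≤ X

  -- The finiteness witness only has to cover P; it may contain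
  -- repetitions and elements outside P.

  cardinality : (P : Pred Curve 0ℓ) → Finite P → ℕ
  cardinality P (Es , _) =
    length (filter (λ E → em {P = P E}) (deduplicate (≡-dec ℤ._≟_ ℤ._≟_) Es))

  private
    open Lemmas

    ints : ℕ → List ℤ
    ints M = map +_ (upTo M) ++ map (ℤ.-_ ∘ +_) (upTo M)

    ∈-ints : ∀ M i → ℤ.∣ i ∣ ℕ.< M → i ∈ ints M
    ∈-ints M (+ n)    h = ∈-++⁺ˡ (∈-map⁺ +_ (∈-upTo⁺ h))
    ∈-ints M -[1+ n ] h = ∈-++⁺ʳ (map +_ (upTo M)) (∈-map⁺ (ℤ.-_ ∘ +_) (∈-upTo⁺ h))

    n≤n^ : ∀ n k → n ℕ.≤ n ℕ.^ suc k
    n≤n^ zero    k = ℕ.z≤n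
    n≤n^ (suc n) k = ℕ.m≤m*n (suc n) (suc n ℕ.^ k) {{ℕ.m^n≢0 (suc n) k}}

    square : ∀ i → i ℤ.^ 2 ≡ + (ℤ.∣ i ∣ ℕ.^ 2)
    square (+ n)    = ≡.trans (≡.cong (+ n ℤ.*_) (≡.sym (ℤ.pos-* n 1))) (≡.sym (ℤ.pos-* n (n ℕ.* 1)))
    square -[1+ n ] = ≡.refl

    γx≤y⇒x≤y : ∀ {γ x y} → 1# ≤ γ → 0# ≤ x → γ * x ≤ y → x ≤ y
    γx≤y⇒x≤y {γ} {x} 1≤γ 0≤x h = O.trans
      (≤-resp (R.*-identityʳ x) (R.*-comm x γ) (*-monoˡ-≤ 0≤x 1≤γ)) h

    small : ∀ {γ X} M n k → 1# ≤ γ → X < fromℕ M → γ * fromℕ (n ℕ.^ suc k) ≤ X → n ℕ.< M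
    small M n k 1≤γ X<M h = ℕ.≰⇒> λ M≤n → <⇒≱ X<M
      (O.trans (fromℕ-mono (ℕ.≤-trans M≤n (n≤n^ n k))) (γx≤y⇒x≤y 1≤γ (0≤fromℕ (n ℕ.^ suc k)) h))

  finite : ∀ {𝓕} X → Finite (𝓕 ⟨ X ⟩)
  finite X with archimedean X
  ... | M , X<M = cartesianProduct (ints M) (ints M) , λ { (A , B) (_ , H≤X) →
    ∈-cartesianProduct⁺
      (∈-ints M A (small M ℤ.∣ A ∣ 2 1≤α X<M (O.trans (MX.x≤x⊔y _ _) H≤X)))
      (∈-ints M B (small M ℤ.∣ B ∣ 1 1≤β X<M
        (≡.subst (λ i → β * fromℤ i ≤ X) (square B) (O.trans (MX.x≤y⊔x _ _) H≤X)))) }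

  #_⟨_⟩ : Pred Curve 0ℓ → Carrier → ℕ
  # 𝓕 ⟨ X ⟩ = cardinality (𝓕 ⟨ X ⟩) (finite X)

  c : Carrier
  c = (1# / (fromℕ 3 ^[ 1 / 2 ] * α ^[ 1 / 6 ])) ⊓ (1# / (fromℕ 2 ^[ 1 / 3 ] * β ^[ 1 / 6 ]))

{-# OPTIONS --safe #-}
module Submission where

open import Defs
open import Level using (0ℓ)
open import Axiom.ExcludedMiddle using (ExcludedMiddle)
open import Algebra.Bundles using (AbelianGroup; CommutativeRing)
import Algebra.Construct.NaturalChoice.Min as Min
import Algebra.Properties.Group as Group
import Algebra.Properties.Semiring.Mult as Mult
import Algebra.Solver.Ring as RingSolver
open import Algebra.Solver.Ring.AlmostCommutativeRing using (fromCommutativeRing; _-Raw-AlmostCommutative⟶_)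
open import Data.Empty using (⊥-elim)
open import Data.Integer.Base as ℤ using (ℤ; +_; -[1+_])
import Data.Integer.Divisibility.Signed as ℤ∣
import Data.Integer.Properties as ℤ
import Data.Integer.Solver as ℤSolver
open import Data.List.Base using (List; []; _∷_; length; map; filter; deduplicate; upTo; _++_; cartesianProduct)
open import Data.List.Membership.Propositional using (_∈_)
open import Data.List.Membership.Propositional.Properties hiding (finite)
open import Data.List.Membership.Propositional.Properties.WithK using (unique∧set⇒bag)
open import Data.List.Properties using (length-map; length-++; length-upTo)
open import Data.List.Relation.Binary.BagAndSetEquality using (∼bag⇒↭)
open import Data.List.Relation.Binary.Permutation.Propositional.Properties using (↭-length)
open import Data.List.Relation.Unary.All using (_∷_)
import Data.List.Relation.Unary.AllPairs as AllPairs
import Data.List.Relation.Unary.Unique.DecPropositional.Properties as DecUnique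
open import Data.List.Relation.Unary.Unique.Propositional using (Unique)
import Data.List.Relation.Unary.Unique.Propositional.Properties as Unique
import Data.Maybe.Base as Maybe
open import Data.Nat.Base as ℕ using (ℕ; zero; suc; NonZero; z≤n; s≤s)
open import Data.Nat.Coprimality as Coprimality using (Coprime; coprime-divisor; coprime-/gcd)
open import Data.Nat.Divisibility
open import Data.Nat.DivMod using (m/n*n≡m)
open import Data.Nat.GCD using (gcd; gcd[m,n]∣m; gcd[m,n]∣n; gcd[m,n]≢0)
open import Data.Nat.Primality using (Prime; prime[2]; prime?; prime⇒nonZero; prime⇒nonTrivial; euclidsLemma)
open import Data.Nat.Primality.Factorisation using (factorise)
import Data.Nat.Properties as ℕ
import Data.Nat.Solver as ℕSolver
open import Data.Product.Base using (∃-syntax; _×_; _,_; proj₁; proj₂)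
open import Data.Product.Properties using (≡-dec)
open import Data.Sum.Base using (_⊎_; inj₁; inj₂; [_,_]′)
open import Function.Bundles using (mk⇔)
open import Relation.Binary.Bundles using (TotalOrder)
import Relation.Binary.Construct.NonStrictToStrict as Strict
open import Relation.Binary.PropositionalEquality as ≡ using (_≡_; _≢_)
import Relation.Binary.Reasoning.PartialOrder as PartialOrderReasoning
import Relation.Binary.Reasoning.Setoid as SetoidReasoning
open import Relation.Nullary using (¬_; Dec; yes; no)
open import Relation.Nullary.Decidable using (dec⇒maybe; from-yes; from-no)
open import Relation.Unary using (Pred)

-- With u = X^{1/6}, the curves of height at most X are the lattice points
-- with α^{1/3} |A| ≤ u² and β^{1/2} |B| ≤ u³, and the singular ones among
-- them are (−3t², 2t³) with |t| ≤ c u.  This gives the exact formula, and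
-- #ℰ̃ = κ u⁵ + O(u³) for u ≥ 1.
--
-- Every nonsingular (A , B) is (d⁴A′, d⁶B′) for a unique d ≥ 1 and a unique
-- (A′, B′) ∈ ℰ, so F(u) = Σ_d G(u/d²) for the counting functions F of ℰ̃ and
-- G of ℰ.  No Möbius inversion is needed: e(u) = G(u) − κ/ζ(10) u⁵ satisfies
-- e(u) = O(u³) − Σ_{d≥2} e(u/d²), and since Σ_{d≥2} d⁻⁶ ≤ 1/2 a bound
-- |e(v)| ≤ K v³ at the smaller arguments v = u/d² reproduces itself at u.

-- Minimal models and singular curves

-- The obstacle is that `ζ 10` is a limit, while F(u) is a finite sum, because large factors d
-- contribute no curve at all. The cut-off is therefore chosen separately for each u, so far out
-- that the missing tail costs κ′u⁵(ζ(10) - S) ≤ 1, where κ′ = κ/ζ(10) and S is the partial sum.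
-- What remains to be met is 11 + K/2 ≤ K, with 10 coming from the count of ℰ̃ and 1 from the tail.
-- The factor 1/2 is decisive: with only Σ d⁻⁶ ≤ 1 the bound would not reproduce itself. The descent
-- ends at u < 1, where G vanishes and the main term κ′u⁵ is itself at most κ′u³.

prime-divisor : ∀ n → n ≢ 1 → ∃[ p ] Prime p × p ∣ n
prime-divisor zero    n≢1 = 2 , prime[2] , 2 ∣0
prime-divisor n@(suc _) n≢1 with factorise n
... | record { factors = [] ; isFactorisation = eq } = ⊥-elim (n≢1 eq)
... | record { factors = p ∷ ps ; isFactorisation = eq ; factorsPrime = pr ∷ _ } =
  p , pr , ≡.subst (p ∣_) (≡.sym eq) (m∣m*n _)

^-monoˡ-∣ : ∀ {m n} k → m ∣ n → m ℕ.^ k ∣ n ℕ.^ k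
^-monoˡ-∣ zero    m∣n = ∣-refl
^-monoˡ-∣ (suc k) m∣n = *-pres-∣ m∣n (^-monoˡ-∣ k m∣n)

coprime-* : ∀ {m n o} → Coprime m n → Coprime m o → Coprime m (n ℕ.* o)
coprime-* m⊥n m⊥o {d} (d∣m , d∣no) = m⊥o (d∣m , coprime-divisor d⊥n d∣no)
  where
  d⊥n : Coprime d _
  d⊥n (e∣d , e∣n) = m⊥n (∣-trans e∣d d∣m , e∣n)

coprime-^ʳ : ∀ {m n} k → Coprime m n → Coprime m (n ℕ.^ k)
coprime-^ʳ zero    m⊥n (_ , d∣1) = ∣1⇒≡1 d∣1
coprime-^ʳ (suc k) m⊥n = coprime-* m⊥n (coprime-^ʳ k m⊥n)

coprime-^ : ∀ {m n} j k → Coprime m n → Coprime (m ℕ.^ j) (n ℕ.^ k)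
coprime-^ j k m⊥n = Coprimality.sym (coprime-^ʳ j (Coprimality.sym (coprime-^ʳ k m⊥n)))

coprime-quotients : ∀ m n → m ≢ 0 →
  ∃[ g ] ∃[ m′ ] ∃[ n′ ] g ≢ 0 × m ≡ m′ ℕ.* g × n ≡ n′ ℕ.* g × Coprime m′ n′
coprime-quotients m n m≢0 =
  gcd m n , m ℕ./ gcd m n , n ℕ./ gcd m n , g≢0 ,
  ≡.sym (m/n*n≡m (gcd[m,n]∣m m n)) , ≡.sym (m/n*n≡m (gcd[m,n]∣n m n)) , coprime-/gcd m n
  where
  g≢0 = gcd[m,n]≢0 m n (inj₁ m≢0)
  instance g-nonZero = ℕ.≢-nonZero g≢0

ℕ-^-distrib-* : ∀ m n k → (m ℕ.* n) ℕ.^ k ≡ m ℕ.^ k ℕ.* n ℕ.^ k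
ℕ-^-distrib-* m n zero    = ≡.refl
ℕ-^-distrib-* m n (suc k) = ≡.trans (≡.cong (m ℕ.* n ℕ.*_) (ℕ-^-distrib-* m n k))
  (solve 4 (λ m n x y → m :* n :* (x :* y) := m :* x :* (n :* y)) ≡.refl m n (m ℕ.^ k) (n ℕ.^ k))
  where open ℕSolver.+-*-Solver

-- Dividing by the gcd leaves coprime m′ and n′ with m′² dividing n′². Then m′ divides n′ · n′,
-- hence n′, so m′ = 1 and m is the gcd itself.
m²∣n²⇒m∣n : ∀ m n → m ℕ.^ 2 ∣ n ℕ.^ 2 → m ∣ n
m²∣n²⇒m∣n zero n 0∣n² =
  ≡.subst (0 ∣_) (≡.sym (ℕ.m^n≡0⇒m≡0 n 2 (0∣⇒≡0 0∣n²))) ∣-refl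
m²∣n²⇒m∣n m@(suc _) n m²∣n² with coprime-quotients m n (λ ())
... | g , m′ , n′ , g≢0 , m≡ , n≡ , m′⊥n′ =
  ≡.subst₂ _∣_ (≡.sym m≡) (≡.sym n≡) (*-monoˡ-∣ g (≡.subst (_∣ n′) (≡.sym m′≡1) (1∣ n′)))
  where
  instance g²-nonZero = ℕ.m^n≢0 g 2 {{ℕ.≢-nonZero g≢0}}
  m′²∣n′² : m′ ℕ.^ 2 ∣ n′ ℕ.^ 2
  m′²∣n′² = *-cancelʳ-∣ (g ℕ.^ 2) (≡.subst₂ _∣_
    (≡.trans (≡.cong (ℕ._^ 2) m≡) (ℕ-^-distrib-* m′ g 2))
    (≡.trans (≡.cong (ℕ._^ 2) n≡) (ℕ-^-distrib-* n′ g 2)) m²∣n²)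
  m′≡1 : m′ ≡ 1
  m′≡1 = m′⊥n′ {m′} (∣-refl , ≡.subst (m′ ∣_) (ℕ.*-identityʳ n′)
    (coprime-divisor m′⊥n′ (∣-trans (m∣m*n (m′ ℕ.* 1)) m′²∣n′²)))

-- The second component of `ℰ`, with integer divisibility unfolded to absolute values; the two are
-- definitionally equal, so proofs pass freely between them.
Minimal : Curve → Set
Minimal (A , B) = ¬ (∃[ p ] Prime p × p ℕ.^ 4 ∣ ℤ.∣ A ∣ × p ℕ.^ 6 ∣ ℤ.∣ B ∣)

minimal-unit : ∀ {A B} → Minimal (A , B) → ∀ d → d ℕ.^ 4 ∣ ℤ.∣ A ∣ → d ℕ.^ 6 ∣ ℤ.∣ B ∣ → d ≡ 1
minimal-unit min d d⁴∣A d⁶∣B with d ℕ.≟ 1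
... | yes d≡1 = d≡1
... | no  d≢1 with prime-divisor d d≢1
...   | p , pr , p∣d =
  ⊥-elim (min (p , pr , ∣-trans (^-monoˡ-∣ 4 p∣d) d⁴∣A , ∣-trans (^-monoˡ-∣ 6 p∣d) d⁶∣B))

scale : ℕ → Curve → Curve
scale d (A , B) = + (d ℕ.^ 4) ℤ.* A , + (d ℕ.^ 6) ℤ.* B

∣scale∣ : ∀ n (i : ℤ) → ℤ.∣ + n ℤ.* i ∣ ≡ n ℕ.* ℤ.∣ i ∣
∣scale∣ n i = ℤ.abs-* (+ n) i

-- Cancelling gᵏ leaves m′ᵏ x = n′ᵏ y, and n′ᵏ is coprime to m′ᵏ. It is applied with k = 4 and k = 6
-- to the two coefficients of a curve that has two models.
coprime-factor-∣ : ∀ {m n m′ n′ g} k {x y} → g ≢ 0 → m ≡ m′ ℕ.* g → n ≡ n′ ℕ.* g → Coprime m′ n′ →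
  m ℕ.^ k ℕ.* x ≡ n ℕ.^ k ℕ.* y → n′ ℕ.^ k ∣ x
coprime-factor-∣ {m′ = m′} {n′} {g} k {x} {y} g≢0 ≡.refl ≡.refl m′⊥n′ eq =
  coprime-divisor (coprime-^ k k (Coprimality.sym m′⊥n′))
    (divides y (ℕ.*-cancelʳ-≡ _ _ (g ℕ.^ k) {{ℕ.m^n≢0 g k {{ℕ.≢-nonZero g≢0}}}} cancelled))
  where
  open ℕSolver.+-*-Solver
  cancelled : m′ ℕ.^ k ℕ.* x ℕ.* g ℕ.^ k ≡ y ℕ.* n′ ℕ.^ k ℕ.* g ℕ.^ k
  cancelled = begin
    m′ ℕ.^ k ℕ.* x ℕ.* g ℕ.^ k
      ≡⟨ solve 3 (λ p x q → p :* x :* q := p :* q :* x) ≡.refl (m′ ℕ.^ k) x (g ℕ.^ k) ⟩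
    m′ ℕ.^ k ℕ.* g ℕ.^ k ℕ.* x  ≡⟨ ≡.cong (ℕ._* x) (ℕ-^-distrib-* m′ g k) ⟨
    (m′ ℕ.* g) ℕ.^ k ℕ.* x      ≡⟨ eq ⟩
    (n′ ℕ.* g) ℕ.^ k ℕ.* y      ≡⟨ ≡.cong (ℕ._* y) (ℕ-^-distrib-* n′ g k) ⟩
    n′ ℕ.^ k ℕ.* g ℕ.^ k ℕ.* y
      ≡⟨ solve 3 (λ p q y → p :* q :* y := y :* p :* q) ≡.refl (n′ ℕ.^ k) (g ℕ.^ k) y ⟩
    y ℕ.* n′ ℕ.^ k ℕ.* g ℕ.^ k  ∎
    where open ≡.≡-Reasoning

scale-injective : ∀ d {E E′} → scale (suc d) E ≡ scale (suc d) E′ → E ≡ E′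
scale-injective d eq = ≡.cong₂ _,_
  (ℤ.*-cancelˡ-≡ (+ (suc d ℕ.^ 4)) _ _ {{ℕ.m^n≢0 (suc d) 4}} (≡.cong proj₁ eq))
  (ℤ.*-cancelˡ-≡ (+ (suc d ℕ.^ 6)) _ _ {{ℕ.m^n≢0 (suc d) 6}} (≡.cong proj₂ eq))

-- Let m′/n′ be the ratio of the two factors in lowest terms. Then n′⁴ and n′⁶ divide the
-- coefficients of the first model, so its minimality forces n′ = 1; by symmetry m′ = 1.
scale-factor-unique : ∀ {d e E E′} → Minimal E → Minimal E′ →
                      scale (suc d) E ≡ scale (suc e) E′ → d ≡ e
scale-factor-unique {d} {e} {A , B} {A′ , B′} min min′ eq
  with coprime-quotients (suc d) (suc e) (λ ())
... | g , m′ , n′ , g≢0 , m≡ , n≡ , m′⊥n′ = ℕ.suc-injective (≡.trans m≡ (≡.trans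
    (≡.cong (ℕ._* g) (≡.trans m′≡1 (≡.sym n′≡1))) (≡.sym n≡)))
  where
  eq₄ : suc d ℕ.^ 4 ℕ.* ℤ.∣ A ∣ ≡ suc e ℕ.^ 4 ℕ.* ℤ.∣ A′ ∣
  eq₄ = ≡.trans (≡.sym (∣scale∣ (suc d ℕ.^ 4) A))
          (≡.trans (≡.cong (λ E → ℤ.∣ proj₁ E ∣) eq) (∣scale∣ (suc e ℕ.^ 4) A′))
  eq₆ : suc d ℕ.^ 6 ℕ.* ℤ.∣ B ∣ ≡ suc e ℕ.^ 6 ℕ.* ℤ.∣ B′ ∣
  eq₆ = ≡.trans (≡.sym (∣scale∣ (suc d ℕ.^ 6) B))
          (≡.trans (≡.cong (λ E → ℤ.∣ proj₂ E ∣) eq) (∣scale∣ (suc e ℕ.^ 6) B′))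
  n′≡1 : n′ ≡ 1
  n′≡1 = minimal-unit {A} {B} min n′
    (coprime-factor-∣ 4 g≢0 m≡ n≡ m′⊥n′ eq₄) (coprime-factor-∣ 6 g≢0 m≡ n≡ m′⊥n′ eq₆)
  m′≡1 : m′ ≡ 1
  m′≡1 = minimal-unit {A′} {B′} min′ m′
    (coprime-factor-∣ 4 g≢0 n≡ m≡ (Coprimality.sym m′⊥n′) (≡.sym eq₄))
    (coprime-factor-∣ 6 g≢0 n≡ m≡ (Coprimality.sym m′⊥n′) (≡.sym eq₆))

pos-^ : ∀ m n → + (m ℕ.^ n) ≡ (+ m) ℤ.^ n
pos-^ m zero    = ≡.refl
pos-^ m (suc n) = ≡.trans (ℤ.pos-* m (m ℕ.^ n)) (≡.cong (+ m ℤ.*_) (pos-^ m n))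

-- Both terms of the discriminant have weight 12 = 4 · 3 = 6 · 2. The solver treats d⁴ and d⁶ as
-- atoms, and `power` then merges (d⁴)³ and (d⁶)² into d¹².
Δ-scale : ∀ d E → Δ (scale d E) ≡ + (d ℕ.^ 12) ℤ.* Δ E
Δ-scale d (A , B) = begin
  Δ (P ℤ.* A , Q ℤ.* B)
    ≡⟨ solve 4 (λ P Q A B → :- con (+ 16) :* (con (+ 4) :* (P :* A) :^ 3 :+ con (+ 27) :* (Q :* B) :^ 2)
             := :- con (+ 16) :* (con (+ 4) :* (P :^ 3 :* A :^ 3) :+ con (+ 27) :* (Q :^ 2 :* B :^ 2)))
         ≡.refl P Q A B ⟩
  ℤ.- + 16 ℤ.* (+ 4 ℤ.* (P ℤ.^ 3 ℤ.* A ℤ.^ 3) ℤ.+ + 27 ℤ.* (Q ℤ.^ 2 ℤ.* B ℤ.^ 2))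
    ≡⟨ ≡.cong₂ (λ p q → ℤ.- + 16 ℤ.* (+ 4 ℤ.* (p ℤ.* A ℤ.^ 3) ℤ.+ + 27 ℤ.* (q ℤ.* B ℤ.^ 2)))
         (power 4 3) (power 6 2) ⟩
  ℤ.- + 16 ℤ.* (+ 4 ℤ.* (T ℤ.* A ℤ.^ 3) ℤ.+ + 27 ℤ.* (T ℤ.* B ℤ.^ 2))
    ≡⟨ solve 3 (λ T x y → :- con (+ 16) :* (con (+ 4) :* (T :* x) :+ con (+ 27) :* (T :* y))
             := T :* (:- con (+ 16) :* (con (+ 4) :* x :+ con (+ 27) :* y)))
         ≡.refl T (A ℤ.^ 3) (B ℤ.^ 2) ⟩
  T ℤ.* Δ (A , B) ∎
  where
  open ≡.≡-Reasoning
  open ℤSolver.+-*-Solver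
  P = + (d ℕ.^ 4)
  Q = + (d ℕ.^ 6)
  T = + (d ℕ.^ 12)
  power : ∀ j k → (+ (d ℕ.^ j)) ℤ.^ k ≡ + (d ℕ.^ (j ℕ.* k))
  power j k = ≡.trans (≡.sym (pos-^ (d ℕ.^ j) k)) (≡.cong +_ (ℕ.^-*-assoc d j k))

ℰ̃-scale : ∀ d E → d ≢ 0 → ℰ̃ E → ℰ̃ (scale d E)
ℰ̃-scale d E d≢0 Δ≢0 eq =
  [ (λ d¹²≡0 → d≢0 (ℕ.m^n≡0⇒m≡0 d 12 (ℤ.+-injective d¹²≡0))) , Δ≢0 ]′
  (ℤ.i*j≡0⇒i≡0∨j≡0 (+ (d ℕ.^ 12)) {Δ E} (≡.trans (≡.sym (Δ-scale d E)) eq))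

ℰ̃-unscale : ∀ d E → ℰ̃ (scale d E) → ℰ̃ E
ℰ̃-unscale d E Δ≢0 eq = Δ≢0 (≡.trans (Δ-scale d E)
  (≡.trans (≡.cong (+ (d ℕ.^ 12) ℤ.*_) eq) (ℤ.*-zeroʳ (+ (d ℕ.^ 12)))))

scale-* : ∀ d e E → scale d (scale e E) ≡ scale (d ℕ.* e) E
scale-* d e (A , B) = ≡.cong₂ _,_ (lemma 4 A) (lemma 6 B)
  where
  lemma : ∀ k i → + (d ℕ.^ k) ℤ.* (+ (e ℕ.^ k) ℤ.* i) ≡ + ((d ℕ.* e) ℕ.^ k) ℤ.* i
  lemma k i = ≡.trans (≡.sym (ℤ.*-assoc (+ (d ℕ.^ k)) (+ (e ℕ.^ k)) i)) (≡.cong (ℤ._* i)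
    (≡.trans (≡.sym (ℤ.pos-* (d ℕ.^ k) (e ℕ.^ k))) (≡.cong +_ (≡.sym (ℕ-^-distrib-* d e k)))))

scale-1 : ∀ E → scale 1 E ≡ E
scale-1 (A , B) = ≡.cong₂ _,_ (ℤ.*-identityˡ A) (ℤ.*-identityˡ B)

-- Serves twice: as the measure that decreases when a prime is removed from a model, and as the
-- bound that makes the set of scaling factors finite.
size : Curve → ℕ
size (A , B) = ℤ.∣ A ∣ ℕ.+ ℤ.∣ B ∣

0<size : ∀ E → ℰ̃ E → 0 ℕ.< size E
0<size (A , B) Δ≢0 = ℕ.n≢0⇒n>0 λ eq → Δ≢0 (≡.cong Δ {A , B} {+ 0 , + 0} (≡.cong₂ _,_
  (ℤ.∣i∣≡0⇒i≡0 (ℕ.m+n≡0⇒m≡0 ℤ.∣ A ∣ eq)) (ℤ.∣i∣≡0⇒i≡0 (ℕ.m+n≡0⇒n≡0 ℤ.∣ A ∣ eq))))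

n≤n^ : ∀ n k → n ℕ.≤ n ℕ.^ suc k
n≤n^ zero    k = z≤n
n≤n^ (suc n) k = ℕ.m≤m*n (suc n) (suc n ℕ.^ k) {{ℕ.m^n≢0 (suc n) k}}

d*size≤size-scale : ∀ d E → d ℕ.* size E ℕ.≤ size (scale d E)
d*size≤size-scale d (A , B) = begin
  d ℕ.* (ℤ.∣ A ∣ ℕ.+ ℤ.∣ B ∣)                     ≡⟨ ℕ.*-distribˡ-+ d ℤ.∣ A ∣ ℤ.∣ B ∣ ⟩
  d ℕ.* ℤ.∣ A ∣ ℕ.+ d ℕ.* ℤ.∣ B ∣                 ≤⟨ ℕ.+-mono-≤ (ℕ.*-monoˡ-≤ ℤ.∣ A ∣ (n≤n^ d 3))
                                                            (ℕ.*-monoˡ-≤ ℤ.∣ B ∣ (n≤n^ d 5)) ⟩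
  d ℕ.^ 4 ℕ.* ℤ.∣ A ∣ ℕ.+ d ℕ.^ 6 ℕ.* ℤ.∣ B ∣     ≡⟨ ≡.cong₂ ℕ._+_ (∣scale∣ (d ℕ.^ 4) A) (∣scale∣ (d ℕ.^ 6) B) ⟨
  size (scale d (A , B))                          ∎
  where open ℕ.≤-Reasoning

size<size-scale : ∀ p E → Prime p → ℰ̃ E → size E ℕ.< size (scale p E)
size<size-scale p E pr Δ≢0 = ℕ.<-≤-trans
  (≡.subst (size E ℕ.<_) (ℕ.*-comm (size E) p)
    (ℕ.m<m*n (size E) p {{ℕ.>-nonZero (0<size E Δ≢0)}} (ℕ.nonTrivial⇒n>1 p {{prime⇒nonTrivial pr}})))
  (d*size≤size-scale p E)

ℕ∣⇒scale : ∀ {n i} → n ∣ ℤ.∣ i ∣ → ∃[ j ] i ≡ + n ℤ.* j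
ℕ∣⇒scale {n} {i} n∣i with ℤ∣.∣ᵤ⇒∣ {+ n} {i} n∣i
... | ℤ∣.divides q eq = q , ≡.trans eq (ℤ.*-comm q (+ n))

-- Primes are divided out as long as the curve is not minimal. A nonzero discriminant excludes (0 ,
-- 0), so the size is positive and strictly drops with each division; n is an upper bound for the
-- number of rounds.
minimal-model : ExcludedMiddle 0ℓ → ∀ E → ℰ̃ E → ∃[ d ] ∃[ E′ ] ℰ E′ × E ≡ scale (suc d) E′
minimal-model em E = go (suc (size E)) E ℕ.≤-refl
  where
  NonMinimal : Curve → Set
  NonMinimal (A , B) = ∃[ p ] Prime p × p ℕ.^ 4 ∣ ℤ.∣ A ∣ × p ℕ.^ 6 ∣ ℤ.∣ B ∣
  unscale : ∀ E → NonMinimal E → ∃[ p ] Prime (suc p) × ∃[ E′ ] E ≡ scale (suc p) E′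
  unscale (A , B) (zero  , pr , _) with () ← prime⇒nonZero pr
  unscale (A , B) (suc p , pr , p⁴∣A , p⁶∣B) =
    let A′ , A≡ = ℕ∣⇒scale {i = A} p⁴∣A
        B′ , B≡ = ℕ∣⇒scale {i = B} p⁶∣B
    in p , pr , (A′ , B′) , ≡.cong₂ _,_ A≡ B≡
  go : ∀ n E → size E ℕ.< n → ℰ̃ E → ∃[ d ] ∃[ E′ ] ℰ E′ × E ≡ scale (suc d) E′
  go (suc n) E size<1+n E∈ℰ̃ = by-minimality em
    where
    by-minimality : Dec (NonMinimal E) → ∃[ d ] ∃[ E′ ] ℰ E′ × E ≡ scale (suc d) E′
    by-minimality (no min) = 0 , E , (E∈ℰ̃ , min) , ≡.sym (scale-1 E)
    -- Factors are stored as predecessors: `d + p * suc d` is one less than `suc p * suc d`.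
    by-minimality (yes nonmin) = d ℕ.+ p ℕ.* suc d , proj₁ (proj₂ rec) , proj₁ (proj₂ (proj₂ rec)) ,
      ≡.trans E≡ (≡.trans (≡.cong (scale (suc p)) (proj₂ (proj₂ (proj₂ rec)))) (scale-* (suc p) (suc d) _))
      where
      p = proj₁ (unscale E nonmin)
      E′ = proj₁ (proj₂ (proj₂ (unscale E nonmin)))
      E≡ : E ≡ scale (suc p) E′
      E≡ = proj₂ (proj₂ (proj₂ (unscale E nonmin)))
      E′∈ℰ̃ : ℰ̃ E′
      E′∈ℰ̃ = ℰ̃-unscale (suc p) E′ (≡.subst ℰ̃ E≡ E∈ℰ̃)
      rec = go n E′ (ℕ.<-≤-trans
        (≡.subst (λ E → size E′ ℕ.< size E) (≡.sym E≡)
          (size<size-scale (suc p) E′ (proj₁ (proj₂ (unscale E nonmin))) E′∈ℰ̃))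
        (ℕ.s≤s⁻¹ size<1+n)) E′∈ℰ̃
      d = proj₁ rec

-- The singular curves: y² = (x − t)² (x + 2 t).
cusp : ℤ → Curve
cusp t = ℤ.- (+ 3 ℤ.* t ℤ.^ 2) , + 2 ℤ.* t ℤ.^ 3

Δ-cusp : ∀ t → Δ (cusp t) ≡ + 0
Δ-cusp = solve 1 (λ t → :- con (+ 16) :* (con (+ 4) :* (:- (con (+ 3) :* t :^ 2)) :^ 3
                        :+ con (+ 27) :* (con (+ 2) :* t :^ 3) :^ 2) := con (+ 0)) ≡.refl
  where open ℤSolver.+-*-Solver

-- The first coefficient gives s² = t², which loses the sign; the second gives s · s² = t · t² = t ·
-- s², and s² can be cancelled unless s = 0.
cusp-injective : ∀ {s t} → cusp s ≡ cusp t → s ≡ t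
cusp-injective {s} {t} eq with s ℤ.≟ + 0
... | yes ≡.refl = ≡.sym (ℤ.i^n≡0⇒i≡0 t 3 (≡.sym (ℤ.*-cancelˡ-≡ (+ 2) (+ 0) _ (≡.cong proj₂ eq))))
... | no  s≢0 = ℤ.*-cancelʳ-≡ s t (s ℤ.^ 2) {{ℤ.≢-nonZero (λ s²≡0 → s≢0 (ℤ.i^n≡0⇒i≡0 s 2 s²≡0))}}
    (≡.trans (ℤ.*-cancelˡ-≡ (+ 2) _ _ (≡.cong proj₂ eq)) (≡.cong (t ℤ.*_) (≡.sym s²≡t²)))
  where
  s²≡t² : s ℤ.^ 2 ≡ t ℤ.^ 2
  s²≡t² = ℤ.*-cancelˡ-≡ (+ 3) _ _ (ℤ.neg-injective (≡.cong proj₁ eq))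

prime-∣^ : ∀ {p m} n → Prime p → p ∣ m ℕ.^ n → p ∣ m
prime-∣^ zero    pr p∣1 = ≡.subst (_∣ _) (≡.sym (∣1⇒≡1 p∣1)) (1∣ _)
prime-∣^ {m = m} (suc n) pr p∣ with euclidsLemma m (m ℕ.^ n) pr p∣
... | inj₁ p∣m  = p∣m
... | inj₂ p∣mⁿ = prime-∣^ n pr p∣mⁿ

-- The root t is recovered as 3 b / 2 a, whose square is a / 3.
cuspidal-ℕ : ∀ a b → a ≢ 0 → 4 ℕ.* a ℕ.^ 3 ≡ 27 ℕ.* b ℕ.^ 2 →
             ∃[ t ] a ≡ 3 ℕ.* t ℕ.^ 2 × b ≡ 2 ℕ.* t ℕ.^ 3
cuspidal-ℕ a b a≢0 eq = helper 3∣a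
  where
  open ℕSolver.+-*-Solver
  open ≡.≡-Reasoning
  3∣a : 3 ∣ a
  3∣a = [ (λ 3∣4 → ⊥-elim (from-no (3 ∣? 4) 3∣4)) , prime-∣^ 3 (from-yes (prime? 3)) ]′
    (euclidsLemma 4 (a ℕ.^ 3) (from-yes (prime? 3)) (divides (9 ℕ.* b ℕ.^ 2) (≡.trans eq
      (solve 1 (λ x → con 27 :* x := con 9 :* x :* con 3) ≡.refl (b ℕ.^ 2)))))
  helper : 3 ∣ a → ∃[ t ] a ≡ 3 ℕ.* t ℕ.^ 2 × b ≡ 2 ℕ.* t ℕ.^ 3
  helper (divides q a≡) = t , a≡3t² , b≡2t³
    where
    q≢0 : q ≢ 0
    q≢0 q≡0 = a≢0 (≡.trans a≡ (≡.cong (ℕ._* 3) q≡0))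
    b²≡ : b ℕ.^ 2 ≡ q ℕ.* (2 ℕ.* q) ℕ.^ 2
    b²≡ = ≡.sym (ℕ.*-cancelˡ-≡ _ _ 27 (begin
      27 ℕ.* (q ℕ.* (2 ℕ.* q) ℕ.^ 2)
        ≡⟨ solve 1 (λ q → con 27 :* (q :* (con 2 :* q) :^ 2) := con 4 :* (q :* con 3) :^ 3) ≡.refl q ⟩
      4 ℕ.* (q ℕ.* 3) ℕ.^ 3  ≡⟨ ≡.cong (λ a → 4 ℕ.* a ℕ.^ 3) a≡ ⟨
      4 ℕ.* a ℕ.^ 3          ≡⟨ eq ⟩
      27 ℕ.* b ℕ.^ 2         ∎))
    2q∣b : 2 ℕ.* q ∣ b
    2q∣b = m²∣n²⇒m∣n (2 ℕ.* q) b (divides q b²≡)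
    t = quotient 2q∣b
    b≡ : b ≡ t ℕ.* (2 ℕ.* q)
    b≡ = m∣n⇒n≡quotient*m 2q∣b
    q≡t² : q ≡ t ℕ.^ 2
    q≡t² = ℕ.*-cancelʳ-≡ q (t ℕ.^ 2) ((2 ℕ.* q) ℕ.^ 2)
      {{ℕ.m^n≢0 (2 ℕ.* q) 2 {{ℕ.m*n≢0 2 q {{_}} {{ℕ.≢-nonZero q≢0}}}}}}
      (≡.trans (≡.sym b²≡) (≡.trans (≡.cong (ℕ._^ 2) b≡) (ℕ-^-distrib-* t (2 ℕ.* q) 2)))
    a≡3t² : a ≡ 3 ℕ.* t ℕ.^ 2
    a≡3t² = ≡.trans a≡ (≡.trans (ℕ.*-comm q 3) (≡.cong (3 ℕ.*_) q≡t²))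
    b≡2t³ : b ≡ 2 ℕ.* t ℕ.^ 3
    b≡2t³ = ≡.trans b≡ (≡.trans (≡.cong (λ q → t ℕ.* (2 ℕ.* q)) q≡t²)
      (solve 1 (λ t → t :* (con 2 :* t :^ 2) := con 2 :* t :^ 3) ≡.refl t))

∣^∣ : ∀ i n → ℤ.∣ i ℤ.^ n ∣ ≡ ℤ.∣ i ∣ ℕ.^ n
∣^∣ i zero    = ≡.refl
∣^∣ i (suc n) = ≡.trans (ℤ.abs-* i (i ℤ.^ n)) (≡.cong (ℤ.∣ i ∣ ℕ.*_) (∣^∣ i n))

square : ∀ i → i ℤ.^ 2 ≡ + (ℤ.∣ i ∣ ℕ.^ 2)
square (+ n)    = ≡.sym (pos-^ n 2)
square -[1+ n ] = ≡.refl

-- For A ≥ 0 both summands are nonnegative, so both vanish.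
singular-nonneg : ∀ a B → + 4 ℤ.* (+ a) ℤ.^ 3 ℤ.+ + 27 ℤ.* B ℤ.^ 2 ≡ + 0 → (+ a , B) ≡ cusp (+ 0)
singular-nonneg a B eq = ≡.cong₂ _,_ (≡.cong +_ a≡0) B≡0
  where
  eqℕ : 4 ℕ.* a ℕ.^ 3 ℕ.+ 27 ℕ.* ℤ.∣ B ∣ ℕ.^ 2 ≡ 0
  eqℕ = ℤ.+-injective (≡.trans (≡.cong₂ ℤ._+_
    (≡.trans (ℤ.pos-* 4 (a ℕ.^ 3)) (≡.cong (+ 4 ℤ.*_) (pos-^ a 3)))
    (≡.trans (ℤ.pos-* 27 (ℤ.∣ B ∣ ℕ.^ 2)) (≡.cong (+ 27 ℤ.*_) (≡.sym (square B))))) eq)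
  a≡0 : a ≡ 0
  a≡0 = ℕ.m^n≡0⇒m≡0 a 3 (ℕ.m*n≡0⇒m≡0 (a ℕ.^ 3) 4
    (≡.trans (ℕ.*-comm (a ℕ.^ 3) 4) (ℕ.m+n≡0⇒m≡0 (4 ℕ.* a ℕ.^ 3) eqℕ)))
  B≡0 : B ≡ + 0
  B≡0 = ℤ.∣i∣≡0⇒i≡0 (ℕ.m^n≡0⇒m≡0 ℤ.∣ B ∣ 2 (ℕ.m*n≡0⇒m≡0 (ℤ.∣ B ∣ ℕ.^ 2) 27
    (≡.trans (ℕ.*-comm (ℤ.∣ B ∣ ℕ.^ 2) 27) (ℕ.m+n≡0⇒n≡0 (4 ℕ.* a ℕ.^ 3) eqℕ))))
-- The coefficient A fixes the parameter only up to sign; the sign of B selects it.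
singular-nonpos : ∀ a B t → a ≡ 3 ℕ.* t ℕ.^ 2 → ℤ.∣ B ∣ ≡ 2 ℕ.* t ℕ.^ 3 → ∃[ s ] (ℤ.- + a , B) ≡ cusp s
singular-nonpos a B t ∣A∣≡ ∣B∣≡ = by-sign B ∣B∣≡
  where
  open ℤSolver.+-*-Solver
  A≡ : ℤ.- + a ≡ ℤ.- (+ 3 ℤ.* (+ t) ℤ.^ 2)
  A≡ = ≡.cong ℤ.-_ (≡.trans (≡.cong +_ ∣A∣≡)
    (≡.trans (ℤ.pos-* 3 (t ℕ.^ 2)) (≡.cong (+ 3 ℤ.*_) (pos-^ t 2))))
  +∣B∣≡ : ∀ {b} → b ≡ 2 ℕ.* t ℕ.^ 3 → + b ≡ + 2 ℤ.* (+ t) ℤ.^ 3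
  +∣B∣≡ b≡ = ≡.trans (≡.cong +_ b≡)
    (≡.trans (ℤ.pos-* 2 (t ℕ.^ 3)) (≡.cong (+ 2 ℤ.*_) (pos-^ t 3)))
  by-sign : ∀ B → ℤ.∣ B ∣ ≡ 2 ℕ.* t ℕ.^ 3 → ∃[ s ] (ℤ.- + a , B) ≡ cusp s
  by-sign (+ b)    b≡ = + t , ≡.cong₂ _,_ A≡ (+∣B∣≡ b≡)
  by-sign -[1+ b ] b≡ = ℤ.- + t , ≡.cong₂ _,_
    (≡.trans A≡ (solve 1 (λ t → :- (con (+ 3) :* t :^ 2) := :- (con (+ 3) :* (:- t) :^ 2)) ≡.refl (+ t)))
    (≡.trans (≡.cong ℤ.-_ (+∣B∣≡ b≡))
      (solve 1 (λ t → :- (con (+ 2) :* t :^ 3) := con (+ 2) :* (:- t) :^ 3) ≡.refl (+ t)))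

singular-abs : ∀ A B → + 4 ℤ.* A ℤ.^ 3 ℤ.+ + 27 ℤ.* B ℤ.^ 2 ≡ + 0 →
               4 ℕ.* ℤ.∣ A ∣ ℕ.^ 3 ≡ 27 ℕ.* ℤ.∣ B ∣ ℕ.^ 2
singular-abs A B eq = begin
  4 ℕ.* ℤ.∣ A ∣ ℕ.^ 3              ≡⟨ ≡.cong (4 ℕ.*_) (∣^∣ A 3) ⟨
  4 ℕ.* ℤ.∣ A ℤ.^ 3 ∣              ≡⟨ ∣scale∣ 4 (A ℤ.^ 3) ⟨
  ℤ.∣ + 4 ℤ.* A ℤ.^ 3 ∣            ≡⟨ ≡.cong ℤ.∣_∣ 4A³≡-27B² ⟩
  ℤ.∣ ℤ.- (+ 27 ℤ.* B ℤ.^ 2) ∣     ≡⟨ ℤ.∣-i∣≡∣i∣ (+ 27 ℤ.* B ℤ.^ 2) ⟩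
  ℤ.∣ + 27 ℤ.* B ℤ.^ 2 ∣           ≡⟨ ∣scale∣ 27 (B ℤ.^ 2) ⟩
  27 ℕ.* ℤ.∣ B ℤ.^ 2 ∣             ≡⟨ ≡.cong (27 ℕ.*_) (∣^∣ B 2) ⟩
  27 ℕ.* ℤ.∣ B ∣ ℕ.^ 2             ∎
  where
  open ≡.≡-Reasoning
  4A³≡-27B² : + 4 ℤ.* A ℤ.^ 3 ≡ ℤ.- (+ 27 ℤ.* B ℤ.^ 2)
  4A³≡-27B² = Group.inverseˡ-unique (AbelianGroup.group ℤ.+-0-abelianGroup) _ _ eq

singular⇒cusp : ∀ E → Δ E ≡ + 0 → ∃[ t ] E ≡ cusp t
singular⇒cusp (A , B) Δ≡0 = by-sign A (ℤ.*-cancelˡ-≡ (ℤ.- + 16) (+ 4 ℤ.* A ℤ.^ 3 ℤ.+ + 27 ℤ.* B ℤ.^ 2) (+ 0) Δ≡0)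
  where
  by-sign : ∀ A → + 4 ℤ.* A ℤ.^ 3 ℤ.+ + 27 ℤ.* B ℤ.^ 2 ≡ + 0 → ∃[ t ] (A , B) ≡ cusp t
  by-sign (+ a)    eq = + 0 , singular-nonneg a B eq
  by-sign -[1+ a ] eq =
    let t , a≡ , b≡ = cuspidal-ℕ (suc a) ℤ.∣ B ∣ (λ ()) (singular-abs -[1+ a ] B eq)
    in singular-nonpos (suc a) B t a≡ b≡

-- Lists of distinct elements

-- Duplicate-free lists with the same elements are equal as bags, hence permutations of each other.
-- The counts of curves below are compared in this way, so the list behind a finiteness witness
-- never has to be computed.
unique-length : ∀ {A : Set} {xs ys : List A} → Unique xs → Unique ys →
                (∀ {x} → x ∈ xs → x ∈ ys) → (∀ {x} → x ∈ ys → x ∈ xs) → length xs ≡ length ys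
unique-length xs! ys! xs⊆ys ys⊆xs = ↭-length (∼bag⇒↭ (unique∧set⇒bag xs! ys! (mk⇔ xs⊆ys ys⊆xs)))

length-cartesianProduct : ∀ {A B : Set} (xs : List A) (ys : List B) →
                          length (cartesianProduct xs ys) ≡ length xs ℕ.* length ys
length-cartesianProduct []       ys = ≡.refl
length-cartesianProduct (x ∷ xs) ys = ≡.trans (length-++ (map (x ,_) ys))
  (≡.cong₂ ℕ._+_ (length-map (x ,_) ys) (length-cartesianProduct xs ys))

-- The negative half starts at -1, so that zero is listed once and the length is exactly 2n + 1.
interval : ℕ → List ℤ
interval n = map +_ (upTo (suc n)) ++ map -[1+_] (upTo n)

length-interval : ∀ n → length (interval n) ≡ suc (2 ℕ.* n)
length-interval n = ≡.trans (length-++ (map +_ (upTo (suc n)))) (≡.cong₂ ℕ._+_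
  (≡.trans (length-map +_ (upTo (suc n))) (length-upTo (suc n)))
  (≡.trans (length-map -[1+_] (upTo n)) (≡.trans (length-upTo n) (≡.sym (ℕ.+-identityʳ n)))))

interval-unique : ∀ n → Unique (interval n)
interval-unique n = Unique.++⁺ (Unique.map⁺ ℤ.+-injective (Unique.upTo⁺ (suc n)))
  (Unique.map⁺ ℤ.-[1+-injective (Unique.upTo⁺ n)) disjoint
  where
  disjoint : ∀ {i} → i ∈ map +_ (upTo (suc n)) × i ∈ map -[1+_] (upTo n) → _
  disjoint (p , q) with ∈-map⁻ +_ p | ∈-map⁻ -[1+_] q
  ... | _ , _ , ≡.refl | _ , _ , ()

∈-interval⁺ : ∀ {n} i → ℤ.∣ i ∣ ℕ.≤ n → i ∈ interval n
∈-interval⁺     (+ m)    m≤n = ∈-++⁺ˡ (∈-map⁺ +_ (∈-upTo⁺ (s≤s m≤n)))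
∈-interval⁺ {n} -[1+ m ] m<n = ∈-++⁺ʳ (map +_ (upTo (suc n))) (∈-map⁺ -[1+_] (∈-upTo⁺ m<n))

∈-interval⁻ : ∀ {n} i → i ∈ interval n → ℤ.∣ i ∣ ℕ.≤ n
∈-interval⁻ {n} i i∈ with ∈-++⁻ (map +_ (upTo (suc n))) i∈
... | inj₁ p with ∈-map⁻ +_ p
...   | m , m∈ , ≡.refl = ℕ.s≤s⁻¹ (∈-upTo⁻ m∈)
∈-interval⁻ {n} i i∈ | inj₂ p with ∈-map⁻ -[1+_] p
...   | m , m∈ , ≡.refl = ∈-upTo⁻ m∈

-- Ordered field arithmetic and roots

module RealAlgebra (em : ExcludedMiddle 0ℓ) (ℝ : CompleteOrderedField) where

  open Reals em ℝ public
  open Lemmas public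
  open CompleteOrderedField ℝ using (*-nonneg; ⁻¹-inverseʳ; supremum) public
  module M = Mult R.semiring

  fromℕ-+ : ∀ m n → fromℕ (m ℕ.+ n) ≈ fromℕ m + fromℕ n
  fromℕ-+ m n = M.×-homo-+ 1# m n

  fromℕ-* : ∀ m n → fromℕ (m ℕ.* n) ≈ fromℕ m * fromℕ n
  fromℕ-* m n = M.×1-homo-* m n

  fromℕ-^ : ∀ m n → fromℕ (m ℕ.^ n) ≈ fromℕ m ^ n
  fromℕ-^ m zero    = R.+-identityʳ 1#
  fromℕ-^ m (suc n) = R.trans (fromℕ-* m (m ℕ.^ n)) (R.*-congˡ (fromℕ-^ m n))

  module _ where
    open SetoidReasoning R.setoid

    fromℤ-neg : ∀ i → fromℤ (ℤ.- i) ≈ - fromℤ i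
    fromℤ-neg (+ zero)  = R.sym RP.-0#≈0#
    fromℤ-neg (+ suc n) = R.refl
    fromℤ-neg -[1+ n ]  = R.sym (RP.-‿involutive _)

    fromℤ-⊖ : ∀ m n → fromℤ (m ℤ.⊖ n) ≈ fromℕ m - fromℕ n
    fromℤ-⊖ m zero = R.sym (R.trans (R.+-congˡ RP.-0#≈0#) (R.+-identityʳ _))
    fromℤ-⊖ zero (suc n) = R.sym (R.+-identityˡ _)
    fromℤ-⊖ (suc m) (suc n) = begin
      fromℤ (suc m ℤ.⊖ suc n)              ≡⟨ ≡.cong fromℤ (ℤ.[1+m]⊖[1+n]≡m⊖n m n) ⟩
      fromℤ (m ℤ.⊖ n)                      ≈⟨ fromℤ-⊖ m n ⟩
      fromℕ m + - fromℕ n                  ≈⟨ R.+-congʳ (+-cancelʳ _ 1#) ⟨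
      (fromℕ m + 1#) + - 1# + - fromℕ n    ≈⟨ R.+-congʳ (R.+-congʳ (R.+-comm _ 1#)) ⟩
      fromℕ (suc m) + - 1# + - fromℕ n     ≈⟨ R.+-assoc _ _ _ ⟩
      fromℕ (suc m) + (- 1# + - fromℕ n)   ≈⟨ R.+-congˡ (RP.-‿+-comm 1# _) ⟩
      fromℕ (suc m) - fromℕ (suc n)        ∎

    fromℤ-+ : ∀ i j → fromℤ (i ℤ.+ j) ≈ fromℤ i + fromℤ j
    fromℤ-+ (+ m)    (+ n)    = fromℕ-+ m n
    fromℤ-+ (+ m)    -[1+ n ] = fromℤ-⊖ m (suc n)
    fromℤ-+ -[1+ m ] (+ n)    = R.trans (fromℤ-⊖ n (suc m)) (R.+-comm _ _)
    fromℤ-+ -[1+ m ] -[1+ n ] = begin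
      - fromℕ (suc (suc (m ℕ.+ n)))     ≡⟨ ≡.cong (λ k → - fromℕ (suc k)) (ℕ.+-suc m n) ⟨
      - fromℕ (suc m ℕ.+ suc n)         ≈⟨ R.-‿cong (fromℕ-+ (suc m) (suc n)) ⟩
      - (fromℕ (suc m) + fromℕ (suc n)) ≈⟨ RP.-‿+-comm _ _ ⟨
      - fromℕ (suc m) - fromℕ (suc n)   ∎

    fromℤ-* : ∀ i j → fromℤ (i ℤ.* j) ≈ fromℤ i * fromℤ j
    fromℤ-* (+ m) (+ n) = R.trans (R.reflexive (≡.cong fromℤ (≡.sym (ℤ.pos-* m n)))) (fromℕ-* m n)
    fromℤ-* (+ m) -[1+ n ] = begin
      fromℤ (+ m ℤ.* -[1+ n ])          ≡⟨ ≡.cong fromℤ (ℤ.neg-distribʳ-* (+ m) (+ suc n)) ⟨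
      fromℤ (ℤ.- (+ m ℤ.* + suc n))     ≈⟨ fromℤ-neg (+ m ℤ.* + suc n) ⟩
      - fromℤ (+ m ℤ.* + suc n)         ≈⟨ R.-‿cong (fromℤ-* (+ m) (+ suc n)) ⟩
      - (fromℕ m * fromℕ (suc n))       ≈⟨ RP.-‿distribʳ-* _ _ ⟩
      fromℕ m * - fromℕ (suc n)         ∎
    fromℤ-* -[1+ m ] (+ n) = begin
      fromℤ (-[1+ m ] ℤ.* + n)          ≡⟨ ≡.cong fromℤ (ℤ.neg-distribˡ-* (+ suc m) (+ n)) ⟨
      fromℤ (ℤ.- (+ suc m ℤ.* + n))     ≈⟨ fromℤ-neg (+ suc m ℤ.* + n) ⟩
      - fromℤ (+ suc m ℤ.* + n)         ≈⟨ R.-‿cong (fromℤ-* (+ suc m) (+ n)) ⟩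
      - (fromℕ (suc m) * fromℕ n)       ≈⟨ RP.-‿distribˡ-* _ _ ⟩
      - fromℕ (suc m) * fromℕ n         ∎
    fromℤ-* -[1+ m ] -[1+ n ] = begin
      fromℕ (suc m ℕ.* suc n)           ≈⟨ fromℕ-* (suc m) (suc n) ⟩
      fromℕ (suc m) * fromℕ (suc n)     ≈⟨ RP.-‿involutive _ ⟨
      - - (fromℕ (suc m) * fromℕ (suc n)) ≈⟨ R.-‿cong (RP.-‿distribˡ-* _ _) ⟩
      - (- fromℕ (suc m) * fromℕ (suc n)) ≈⟨ RP.-‿distribʳ-* _ _ ⟩
      - fromℕ (suc m) * - fromℕ (suc n) ∎

  -- Equality of real numbers does not compute, so the ring solver takes its coefficients from the
  -- integers; numerals such as `fromℕ 4` are then normalised by integer arithmetic.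
  ℤ-morphism : CommutativeRing.rawRing ℤ.+-*-commutativeRing -Raw-AlmostCommutative⟶ fromCommutativeRing commutativeRing
  ℤ-morphism = record
    { ⟦_⟧    = fromℤ
    ; +-homo = fromℤ-+
    ; *-homo = fromℤ-*
    ; -‿homo = fromℤ-neg
    ; 0-homo = R.refl
    ; 1-homo = R.+-identityʳ 1#
    }

  open RingSolver (CommutativeRing.rawRing ℤ.+-*-commutativeRing) (fromCommutativeRing commutativeRing)
    ℤ-morphism (λ i j → Maybe.map (λ p → R.reflexive (≡.cong fromℤ p)) (dec⇒maybe (i ℤ.≟ j))) public
    using (solve; _:=_; con; _:+_; _:*_; _:-_; :-_; _:^_; Polynomial)

  -- con (+ 1) denotes 1# + 0#, which is not definitionally 1#; a zeroth power is.
  :1 : ∀ {n} → Polynomial n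
  :1 = con (+ 0) :^ 0

  module ≤-Reasoning = PartialOrderReasoning (TotalOrder.poset totalOrder)

  ≰⇒> : ∀ {x y} → ¬ x ≤ y → y < x
  ≰⇒> = Strict.≰⇒> _≈_ _≤_ R.sym O.reflexive O.total

  <-≤-trans : ∀ {x y z} → x < y → y ≤ z → x < z
  <-≤-trans = Strict.<-≤-trans _≈_ _≤_ R.sym O.trans O.antisym O.≤-respʳ-≈

  <-resp : ∀ {x x′ y y′} → x ≈ x′ → y ≈ y′ → x < y → x′ < y′
  <-resp p q h = ≤-<-trans (O.reflexive (R.sym p)) (<-≤-trans h (O.reflexive q))

  0<1 : 0# < 1#
  0<1 = ≰⇒> 1≰0

  ≤⊎> : ∀ x y → x ≤ y ⊎ y < x
  ≤⊎> x y with em {P = x ≤ y}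
  ... | yes h = inj₁ h
  ... | no  h = inj₂ (≰⇒> h)

  +-mono-≤ : ∀ {w x y z} → w ≤ x → y ≤ z → w + y ≤ x + z
  +-mono-≤ {x = x} {y} w≤x y≤z = O.trans (CompleteOrderedField.+-monoˡ-≤ ℝ y w≤x) (+-monoʳ-≤ x y≤z)

  *-monoʳ-≤ : ∀ {z x y} → 0# ≤ z → x ≤ y → x * z ≤ y * z
  *-monoʳ-≤ 0≤z x≤y = ≤-resp (R.*-comm _ _) (R.*-comm _ _) (*-monoˡ-≤ 0≤z x≤y)

  *-mono-≤ : ∀ {w x y z} → 0# ≤ w → 0# ≤ z → w ≤ x → y ≤ z → w * y ≤ x * z
  *-mono-≤ 0≤w 0≤z w≤x y≤z = O.trans (*-monoˡ-≤ 0≤w y≤z) (*-monoʳ-≤ 0≤z w≤x)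

  +-nonneg : ∀ {x y} → 0# ≤ x → 0# ≤ y → 0# ≤ x + y
  +-nonneg 0≤x 0≤y = ≤-resp (R.+-identityʳ 0#) R.refl (+-mono-≤ 0≤x 0≤y)

  0<⇒≉0 : ∀ {x} → 0# < x → ¬ x ≈ 0#
  0<⇒≉0 (_ , 0≉x) x≈0 = 0≉x (R.sym x≈0)

  1≤⇒0< : ∀ {x} → 1# ≤ x → 0# < x
  1≤⇒0< = <-≤-trans 0<1

  *-inverse : ∀ {x} → 0# < x → x * x ⁻¹ ≈ 1#
  *-inverse 0<x = ⁻¹-inverseʳ _ (0<⇒≉0 0<x)

  *-/-cancel : ∀ {x} y → 0# < x → x * (y / x) ≈ y
  *-/-cancel {x} y 0<x = begin
    x * (y * x ⁻¹) ≈⟨ solve 3 (λ x y z → x :* (y :* z) := y :* (x :* z)) R.refl x y (x ⁻¹) ⟩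
    y * (x * x ⁻¹) ≈⟨ R.*-congˡ (*-inverse 0<x) ⟩
    y * 1#         ≈⟨ R.*-identityʳ y ⟩
    y              ∎
    where open SetoidReasoning R.setoid

  0≤⁻¹ : ∀ {x} → 0# < x → 0# ≤ x ⁻¹
  0≤⁻¹ {x} 0<x with O.total 0# (x ⁻¹)
  ... | inj₁ h = h
  ... | inj₂ h = ⊥-elim (1≰0 (≤-resp (*-inverse 0<x) (R.zeroʳ x) (*-monoˡ-≤ (proj₁ 0<x) h)))

  0≤/ : ∀ {x y} → 0# ≤ x → 0# < y → 0# ≤ x / y
  0≤/ 0≤x 0<y = *-nonneg 0≤x (0≤⁻¹ 0<y)

  *≤⇒≤/ : ∀ {x y z} → 0# < z → z * x ≤ y → x ≤ y / z
  *≤⇒≤/ {x} {y} {z} 0<z h = ≤-resp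
    (R.trans (R.*-congʳ (R.*-comm z x)) (R.trans (R.*-assoc x z _)
      (R.trans (R.*-congˡ (*-inverse 0<z)) (R.*-identityʳ x))))
    R.refl (*-monoʳ-≤ (0≤⁻¹ 0<z) h)

  ≤/⇒*≤ : ∀ {x y z} → 0# < z → x ≤ y / z → z * x ≤ y
  ≤/⇒*≤ {x} {y} 0<z h = ≤-resp R.refl (*-/-cancel y 0<z) (*-monoˡ-≤ (proj₁ 0<z) h)

  */-cancel : ∀ {z} x → 0# < z → z * x / z ≈ x
  */-cancel x 0<z = R.trans (R.*-assoc _ x _) (*-/-cancel x 0<z)

  *-cancelˡ-≈ : ∀ {x y z} → 0# < z → z * x ≈ z * y → x ≈ y
  *-cancelˡ-≈ {x} {y} 0<z eq = R.trans (R.sym (*/-cancel x 0<z)) (R.trans (R.*-congʳ eq) (*/-cancel y 0<z))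

  *-pos : ∀ {x y} → 0# < x → 0# < y → 0# < x * y
  *-pos {x} {y} 0<x 0<y = *-nonneg (proj₁ 0<x) (proj₁ 0<y) ,
    λ 0≈xy → proj₂ 0<y (*-cancelˡ-≈ 0<x (R.trans (R.zeroʳ x) 0≈xy))

  0</ : ∀ {x y} → 0# < x → 0# < y → 0# < x / y
  0</ {x} {y} 0<x 0<y = 0≤/ (proj₁ 0<x) 0<y , λ eq → proj₂ 0<x
    (R.trans (R.sym (R.zeroʳ y)) (R.trans (R.*-congˡ eq) (*-/-cancel x 0<y)))

  -- Powers and n-th roots

  ^-pos : ∀ {x} n → 0# < x → 0# < x ^ n
  ^-pos zero    0<x = 0<1
  ^-pos (suc n) 0<x = *-pos 0<x (^-pos n 0<x)

  ^-mono-≤ : ∀ {x y} n → 0# ≤ x → x ≤ y → x ^ n ≤ y ^ n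
  ^-mono-≤ zero    0≤x x≤y = O.refl
  ^-mono-≤ (suc n) 0≤x x≤y = *-mono-≤ 0≤x (^-nonneg n (O.trans 0≤x x≤y)) x≤y (^-mono-≤ n 0≤x x≤y)

  -- Equal powers would give y · yⁿ = x · xⁿ ≤ x · yⁿ, and cancelling yⁿ > 0 contradicts x < y.
  ^-mono-< : ∀ {x y} n → 0# ≤ x → x < y → x ^ suc n < y ^ suc n
  ^-mono-< {x} {y} n 0≤x x<y = ^-mono-≤ (suc n) 0≤x (proj₁ x<y) , λ eq →
    <⇒≱ x<y (≤-resp (cancel y) (cancel x)
      (*-monoʳ-≤ (0≤⁻¹ 0<yⁿ) (O.trans (O.reflexive (R.sym eq)) (*-monoˡ-≤ 0≤x (^-mono-≤ n 0≤x (proj₁ x<y))))))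
    where
    0<yⁿ : 0# < y ^ n
    0<yⁿ = ^-pos n (≤-<-trans 0≤x x<y)
    cancel : ∀ z → z * y ^ n * (y ^ n) ⁻¹ ≈ z
    cancel z = R.trans (R.*-assoc z _ _) (R.trans (R.*-congˡ (*-inverse 0<yⁿ)) (R.*-identityʳ z))

  ^-cancel-≤ : ∀ {x y} n .{{_ : NonZero n}} → 0# ≤ y → x ^ n ≤ y ^ n → x ≤ y
  ^-cancel-≤ (suc n) 0≤y h = ≮⇒≥ λ y<x → <⇒≱ (^-mono-< n 0≤y y<x) h

  ^-cancel-≈ : ∀ {x y} n .{{_ : NonZero n}} → 0# ≤ x → 0# ≤ y → x ^ n ≈ y ^ n → x ≈ y
  ^-cancel-≈ n 0≤x 0≤y eq =
    O.antisym (^-cancel-≤ n 0≤y (O.reflexive eq)) (^-cancel-≤ n 0≤x (O.reflexive (R.sym eq)))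

  -- A one-sided Lipschitz bound at r that replaces the binomial theorem. K must not depend on h;
  -- this is why h ≤ 1 is imposed and r + h is estimated by r + 1.
  ^-growth : ∀ {r} n → 0# ≤ r →
    ∃[ K ] 0# ≤ K × (∀ h → 0# ≤ h → h ≤ 1# → (r + h) ^ n ≤ r ^ n + h * K)
  ^-growth zero 0≤r = 0# , O.refl , λ h _ _ →
    O.reflexive (solve 1 (λ h → :1 := :1 :+ h :* con (+ 0)) R.refl h)
  ^-growth {r} (suc n) 0≤r with ^-growth n 0≤r
  ... | K , 0≤K , bound = r ^ n + (r + 1#) * K , +-nonneg (^-nonneg n 0≤r) (*-nonneg (+-nonneg 0≤r 0≤1) 0≤K) ,
    λ h 0≤h h≤1 → begin
      (r + h) * (r + h) ^ n          ≤⟨ *-monoˡ-≤ (+-nonneg 0≤r 0≤h) (bound h 0≤h h≤1) ⟩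
      (r + h) * (r ^ n + h * K)
        ≈⟨ solve 4 (λ r h p K → (r :+ h) :* (p :+ h :* K) := r :* p :+ h :* (p :+ (r :+ h) :* K)) R.refl r h (r ^ n) K ⟩
      r * r ^ n + h * (r ^ n + (r + h) * K)
        ≤⟨ +-monoʳ-≤ _ (*-monoˡ-≤ 0≤h (+-monoʳ-≤ _ (*-monoʳ-≤ 0≤K (+-monoʳ-≤ r h≤1)))) ⟩
      r * r ^ n + h * (r ^ n + (r + 1#) * K) ∎
    where open ≤-Reasoning

  -- The counterpart to the left of r. The condition h ≤ r keeps the base r - h nonnegative, which
  -- the induction needs to multiply inequalities by it.
  ^-decay : ∀ {r} n → 0# ≤ r →
    ∃[ K ] 0# ≤ K × (∀ h → 0# ≤ h → h ≤ r → r ^ n ≤ (r - h) ^ n + h * K)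
  ^-decay zero 0≤r = 0# , O.refl , λ h _ _ →
    O.reflexive (solve 1 (λ h → :1 := :1 :+ h :* con (+ 0)) R.refl h)
  ^-decay {r} (suc n) 0≤r with ^-decay n 0≤r
  ... | K , 0≤K , bound = r ^ n + r * K , +-nonneg (^-nonneg n 0≤r) (*-nonneg 0≤r 0≤K) ,
    λ h 0≤h h≤r → begin
      r * r ^ n
        ≈⟨ solve 3 (λ r h p → r :* p := (r :- h) :* p :+ h :* p) R.refl r h (r ^ n) ⟩
      (r - h) * r ^ n + h * r ^ n
        ≤⟨ +-mono-≤ (*-monoˡ-≤ (0≤y-x h≤r) (bound h 0≤h h≤r)) O.refl ⟩
      (r - h) * ((r - h) ^ n + h * K) + h * r ^ n
        ≈⟨ solve 5 (λ r h p q K → (r :- h) :* (p :+ h :* K) :+ h :* q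
                 := ((r :- h) :* p :+ h :* (q :+ r :* K)) :- h :* h :* K) R.refl r h ((r - h) ^ n) (r ^ n) K ⟩
      ((r - h) * (r - h) ^ n + h * (r ^ n + r * K)) - h * h * K
        ≤⟨ x-y≤x (*-nonneg (*-nonneg 0≤h 0≤h) 0≤K) ⟩
      (r - h) * (r - h) ^ n + h * (r ^ n + r * K) ∎
    where
    open ≤-Reasoning
    x-y≤x : ∀ {x y} → 0# ≤ y → x - y ≤ x
    x-y≤x {x} 0≤y = ≤-resp R.refl (R.trans (R.+-congˡ RP.-0#≈0#) (R.+-identityʳ x)) (+-monoʳ-≤ x (neg-≤ 0≤y))

  -- The denominator 1 + K + δ dominates both δ and K and is positive, so the single quotient
  -- satisfies both upper bounds.
  small-step : ∀ {δ K} → 0# < δ → 0# ≤ K → ∃[ t ] 0# < t × t ≤ 1# × t * K ≤ δ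
  small-step {δ} {K} 0<δ 0≤K = t , 0</ 0<δ 0<s ,
    ≤-resp R.refl (*-inverse 0<s) (*-monoʳ-≤ (0≤⁻¹ 0<s) δ≤s) ,
    ≤-resp (R.*-comm K t) (*-/-cancel δ 0<s) (*-monoʳ-≤ (0≤/ (proj₁ 0<δ) 0<s) K≤s)
    where
    s = 1# + (K + δ)
    t = δ / s
    0<s : 0# < s
    0<s = 1≤⇒0< (≤-resp (R.+-identityʳ 1#) R.refl (+-monoʳ-≤ 1# (+-nonneg 0≤K (proj₁ 0<δ))))
    K+δ≤s : K + δ ≤ s
    K+δ≤s = ≤-resp R.refl (R.+-comm (K + δ) 1#) x≤x+1
    δ≤s : δ ≤ s
    δ≤s = O.trans (≤-resp (R.+-identityˡ δ) R.refl (+-mono-≤ 0≤K O.refl)) K+δ≤s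
    K≤s : K ≤ s
    K≤s = O.trans (≤-resp (R.+-identityʳ K) R.refl (+-monoʳ-≤ K (proj₁ 0<δ))) K+δ≤s

  0<y-x : ∀ {x y} → x < y → 0# < y - x
  0<y-x {x} {y} x<y = ≰⇒> λ h → <⇒≱ x<y (≤-resp (-+-cancel y x) (R.+-identityˡ x)
    (CompleteOrderedField.+-monoˡ-≤ ℝ x h))

  module _ (k : ℕ) {x : Carrier} (0≤x : 0# ≤ x) where
    private
      n = suc k
      r = root n x
      sup = supremum (RootCandidate n x) (0# , inj₁ R.refl) (1# ⊔ x , rootCandidate-bounded n x)
      upper = proj₁ (proj₂ sup)
      least = proj₂ (proj₂ sup)

      0≤r : 0# ≤ r
      0≤r = upper 0# (inj₁ R.refl)

      r≮r-h : ∀ {h} → 0# < h → ¬ r ≤ r - h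
      r≮r-h {h} 0<h r≤r-h = <⇒≱ 0<h (≤-resp
        (solve 2 (λ r h → (r :+ h) :- r := h) R.refl r h) (R.-‿inverseʳ r)
        (CompleteOrderedField.+-monoˡ-≤ ℝ (- r) (x≤y-z⇒x+z≤y r≤r-h)))

    root-nonneg : 0# ≤ root (suc k) x
    root-nonneg = 0≤r

    -- If rⁿ were below x, a slightly larger r + h would still be a candidate, and r would not be an
    -- upper bound.
    root-^-≥ : x ≤ root (suc k) x ^ suc k
    root-^-≥ = ≮⇒≥ absurd
      where
      absurd : ¬ r ^ n < x
      absurd rⁿ<x = <⇒≱ r<r+h (upper (r + h) (inj₂ (+-nonneg 0≤r (proj₁ 0<h) ,
        (begin
          (r + h) ^ n         ≤⟨ bound h (proj₁ 0<h) h≤1 ⟩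
          r ^ n + h * K       ≤⟨ +-monoʳ-≤ (r ^ n) hK≤ ⟩
          r ^ n + (x - r ^ n) ≈⟨ solve 2 (λ p x → p :+ (x :- p) := x) R.refl (r ^ n) x ⟩
          x                   ∎))))
        where
        open ≤-Reasoning
        growth = ^-growth n 0≤r
        K = proj₁ growth
        bound = proj₂ (proj₂ growth)
        step = small-step {x - r ^ n} {K} (0<y-x rⁿ<x) (proj₁ (proj₂ growth))
        h = proj₁ step
        0<h = proj₁ (proj₂ step)
        h≤1 = proj₁ (proj₂ (proj₂ step))
        hK≤ = proj₂ (proj₂ (proj₂ step))
        r<r+h : r < r + h
        r<r+h = ≰⇒> λ r+h≤r → r≮r-h 0<h (x+z≤y⇒x≤y-z r+h≤r)

    -- If rⁿ were above x, the smaller r - h would still bound all candidates, and r would not be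
    -- the least bound.
    root-^-≤ : root (suc k) x ^ suc k ≤ x
    root-^-≤ = ≮⇒≥ absurd
      where
      absurd : ¬ x < r ^ n
      absurd x<rⁿ = r≮r-h 0<h (least (r - h) λ
            { y (inj₁ y≈0) → O.trans (O.reflexive y≈0) 0≤r-h
            ; y (inj₂ (0≤y , yⁿ≤x)) → ^-cancel-≤ n 0≤r-h (O.trans yⁿ≤x x≤[r-h]ⁿ) })
        where
        open ≤-Reasoning
        decay = ^-decay n 0≤r
        K = proj₁ decay
        bound = proj₂ (proj₂ decay)
        -- The step is taken relative to r, as h = t · r with t ≤ 1, to guarantee h ≤ r; the
        -- constant to be beaten thus becomes r · K.
        step = small-step {r ^ n - x} {r * K} (0<y-x x<rⁿ) (*-nonneg 0≤r (proj₁ (proj₂ decay)))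
        t = proj₁ step
        0<t = proj₁ (proj₂ step)
        t≤1 = proj₁ (proj₂ (proj₂ step))
        trK≤ = proj₂ (proj₂ (proj₂ step))
        h = t * r
        0<r : 0# < r
        0<r = 0≤r , λ 0≈r → <⇒≱ x<rⁿ (O.trans
          (O.reflexive (R.trans (R.*-congʳ (R.sym 0≈r)) (R.zeroˡ _))) 0≤x)
        0<h : 0# < h
        0<h = *-pos 0<t 0<r
        h≤r : h ≤ r
        h≤r = ≤-resp R.refl (R.*-identityˡ r) (*-monoʳ-≤ 0≤r t≤1)
        0≤r-h : 0# ≤ r - h
        0≤r-h = 0≤y-x h≤r
        x≤[r-h]ⁿ : x ≤ (r - h) ^ n
        x≤[r-h]ⁿ = begin
          x
            ≈⟨ solve 2 (λ p x → x := p :- (p :- x)) R.refl (r ^ n) x ⟩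
          r ^ n - (r ^ n - x)
            ≤⟨ +-mono-≤ (bound h (proj₁ 0<h) h≤r) (neg-≤ trK≤) ⟩
          ((r - h) ^ n + t * r * K) - t * (r * K)
            ≈⟨ solve 4 (λ p t r K → (p :+ t :* r :* K) :- t :* (r :* K) := p) R.refl ((r - h) ^ n) t r K ⟩
          (r - h) ^ n ∎

    root-^ : root (suc k) x ^ suc k ≈ x
    root-^ = O.antisym root-^-≤ root-^-≥

    root-unique : ∀ {y} → 0# ≤ y → y ^ suc k ≈ x → root (suc k) x ≈ y
    root-unique 0≤y yⁿ≈x = ^-cancel-≈ (suc k) 0≤r 0≤y (R.trans root-^ (R.sym yⁿ≈x))

-- Counting curves

module Asymptotics (em : ExcludedMiddle 0ℓ) (ℝ : CompleteOrderedField)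
  (α β : CompleteOrderedField.Carrier ℝ)
  (1≤α : CompleteOrderedField._≤_ ℝ (CompleteOrderedField.1# ℝ) α)
  (1≤β : CompleteOrderedField._≤_ ℝ (CompleteOrderedField.1# ℝ) β) where

  open RealAlgebra em ℝ
  open Counting em ℝ α β 1≤α 1≤β

  fromℕ-cancel-≤ : ∀ {m n} → fromℕ m < fromℕ (suc n) → m ℕ.≤ n
  fromℕ-cancel-≤ {m} {n} h = ℕ.≮⇒≥ λ n<m → <⇒≱ h (fromℕ-mono n<m)

  floor-spec : ∀ {x} → 0# ≤ x → ∃[ n ] ⌊ x ⌋ ≡ + n × fromℕ n ≤ x × x < fromℕ (suc n)
  floor-spec {x} 0≤x = nonneg (floor-exists x)
    where
    nonneg : (e : ∃[ n ] fromℤ n ≤ x × x < fromℤ (ℤ.suc n)) →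
             ∃[ n ] proj₁ e ≡ + n × fromℕ n ≤ x × x < fromℕ (suc n)
    nonneg (+ n , n≤x , x<1+n) = n , ≡.refl , n≤x , x<1+n
    nonneg (-[1+ zero ] , _ , x<0) = ⊥-elim (<⇒≱ x<0 0≤x)
    nonneg (-[1+ suc n ] , _ , x<-n) = ⊥-elim (<⇒≱ x<-n
      (O.trans (≤-resp R.refl RP.-0#≈0# (neg-≤ (0≤fromℕ (suc n)))) 0≤x))

  -- The list whose length `cardinality` is by definition, named so that membership and uniqueness
  -- can be stated for it.
  enum : (P : Pred Curve 0ℓ) → Finite P → List Curve
  enum P (Es , _) = filter (λ E → em {P = P E}) (deduplicate (≡-dec ℤ._≟_ ℤ._≟_) Es)

  enum-unique : ∀ P fin → Unique (enum P fin)
  enum-unique P (Es , _) = Unique.filter⁺ (λ E → em {P = P E})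
    (DecUnique.deduplicate-! (≡-dec ℤ._≟_ ℤ._≟_) Es)

  ∈-enum⁺ : ∀ P fin {E} → P E → E ∈ enum P fin
  ∈-enum⁺ P (Es , complete) PE = ∈-filter⁺ (λ E → em {P = P E})
    (∈-deduplicate⁺ (≡-dec ℤ._≟_ ℤ._≟_) (complete _ PE)) PE

  ∈-enum⁻ : ∀ P fin {E} → E ∈ enum P fin → P E
  ∈-enum⁻ P (Es , _) E∈ = proj₂ (∈-filter⁻ (λ E → em {P = P E})
    {xs = deduplicate (≡-dec ℤ._≟_ ℤ._≟_) Es} E∈)

  cardinality-cong : ∀ {P Q} finP finQ → (∀ {E} → P E → Q E) → (∀ {E} → Q E → P E) →
                     cardinality P finP ≡ cardinality Q finQ
  cardinality-cong {P} {Q} finP finQ P⇒Q Q⇒P = unique-length (enum-unique P finP) (enum-unique Q finQ)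
    (λ E∈ → ∈-enum⁺ Q finQ (P⇒Q (∈-enum⁻ P finP E∈)))
    (λ E∈ → ∈-enum⁺ P finP (Q⇒P (∈-enum⁻ Q finQ E∈)))

  #-cong : ∀ 𝓕 {X Y} → X ≈ Y → # 𝓕 ⟨ X ⟩ ≡ # 𝓕 ⟨ Y ⟩
  #-cong 𝓕 {X} {Y} X≈Y = cardinality-cong (finite X) (finite Y)
    (λ (E∈𝓕 , H≤X) → E∈𝓕 , O.trans H≤X (O.reflexive X≈Y))
    (λ (E∈𝓕 , H≤Y) → E∈𝓕 , O.trans H≤Y (O.reflexive (R.sym X≈Y)))

  x^1≈x : ∀ x → x ^ 1 ≈ x
  x^1≈x = R.*-identityʳ

  1≤root : ∀ k {x} → 1# ≤ x → 1# ≤ root (suc k) x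
  1≤root k {x} 1≤x = ^-cancel-≤ (suc k) (root-nonneg k 0≤x)
    (≤-resp (R.sym (1^n (suc k))) (R.sym (root-^ k 0≤x)) 1≤x)
    where
    0≤x = O.trans 0≤1 1≤x

  1≤^[1/] : ∀ k {x} → 1# ≤ x → 1# ≤ x ^[ 1 / suc k ]
  1≤^[1/] k 1≤x = ≤-resp R.refl (R.sym (x^1≈x _)) (1≤root k 1≤x)

  ^[1/]-^ : ∀ k {x} → 0# ≤ x → (x ^[ 1 / suc k ]) ^ suc k ≈ x
  ^[1/]-^ k 0≤x = R.trans (E.^-congˡ (suc k) (x^1≈x _)) (root-^ k 0≤x)

  ^[1/]-unique : ∀ k {x y} → 0# ≤ x → 0# ≤ y → y ^ suc k ≈ x → x ^[ 1 / suc k ] ≈ y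
  ^[1/]-unique k 0≤x 0≤y eq = R.trans (x^1≈x _) (root-unique k 0≤x 0≤y eq)

  0≤α : 0# ≤ α
  0≤α = O.trans 0≤1 1≤α
  0≤β : 0# ≤ β
  0≤β = O.trans 0≤1 1≤β

  a b : Carrier
  a = α ^[ 1 / 3 ]
  b = β ^[ 1 / 2 ]

  1≤a : 1# ≤ a
  1≤a = 1≤^[1/] 2 1≤α
  1≤b : 1# ≤ b
  1≤b = 1≤^[1/] 1 1≤β
  0<a : 0# < a
  0<a = 1≤⇒0< 1≤a
  0<b : 0# < b
  0<b = 1≤⇒0< 1≤b

  Box : Carrier → Curve → Set
  Box u (A , B) = a * fromℕ ℤ.∣ A ∣ ≤ u ^ 2 × b * fromℕ ℤ.∣ B ∣ ≤ u ^ 3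

  module _ {X u : Carrier} (0≤u : 0# ≤ u) (u⁶≈X : u ^ 6 ≈ X) where
    private
      module _ (A B : ℤ) where
        m = ℤ.∣ A ∣
        n = ℤ.∣ B ∣
        A-term : (a * fromℕ m) ^ 3 ≈ α * fromℕ (m ℕ.^ 3)
        A-term = R.trans (^-distrib-* a (fromℕ m) 3)
          (R.*-cong (^[1/]-^ 2 0≤α) (R.sym (fromℕ-^ m 3)))
        B-term : (b * fromℕ n) ^ 2 ≈ β * fromℤ (B ℤ.^ 2)
        B-term = R.trans (^-distrib-* b (fromℕ n) 2)
          (R.*-cong (^[1/]-^ 1 0≤β) (R.trans (R.sym (fromℕ-^ n 2)) (R.reflexive (≡.cong fromℤ (≡.sym (square B))))))
      [u²]³≈X : (u ^ 2) ^ 3 ≈ X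
      [u²]³≈X = R.trans (E.^-assocʳ u 2 3) u⁶≈X
      [u³]²≈X : (u ^ 3) ^ 2 ≈ X
      [u³]²≈X = R.trans (E.^-assocʳ u 3 2) u⁶≈X

    H≤⇒Box : ∀ E → H E ≤ X → Box u E
    H≤⇒Box (A , B) H≤X =
      ^-cancel-≤ 3 (^-nonneg 2 0≤u) (≤-resp (R.sym (A-term A B)) (R.sym [u²]³≈X) (O.trans (MX.x≤x⊔y _ _) H≤X)) ,
      ^-cancel-≤ 2 (^-nonneg 3 0≤u) (≤-resp (R.sym (B-term A B)) (R.sym [u³]²≈X) (O.trans (MX.x≤y⊔x _ _) H≤X))

    Box⇒H≤ : ∀ E → Box u E → H E ≤ X
    Box⇒H≤ (A , B) (A≤ , B≤) = MX.⊔-lub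
      (≤-resp (A-term A B) [u²]³≈X (^-mono-≤ 3 (*-nonneg (proj₁ 0<a) (0≤fromℕ ℤ.∣ A ∣)) A≤))
      (≤-resp (B-term A B) [u³]²≈X (^-mono-≤ 2 (*-nonneg (proj₁ 0<b) (0≤fromℕ ℤ.∣ B ∣)) B≤))

  ∣cusp∣ : ∀ t → ℤ.∣ proj₁ (cusp t) ∣ ≡ 3 ℕ.* ℤ.∣ t ∣ ℕ.^ 2 × ℤ.∣ proj₂ (cusp t) ∣ ≡ 2 ℕ.* ℤ.∣ t ∣ ℕ.^ 3
  ∣cusp∣ t =
    ≡.trans (ℤ.∣-i∣≡∣i∣ (+ 3 ℤ.* t ℤ.^ 2)) (≡.trans (∣scale∣ 3 (t ℤ.^ 2)) (≡.cong (3 ℕ.*_) (∣^∣ t 2))) ,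
    ≡.trans (∣scale∣ 2 (t ℤ.^ 3)) (≡.cong (2 ℕ.*_) (∣^∣ t 3))

  -- The box of lattice points is the disjoint union of the nonsingular curves and the injectively
  -- parametrised cusps; Δ separates the two. The identity is additive to avoid truncated
  -- subtraction, and M, N, T enter only as largest admissible integers, which keeps floors out of
  -- the combinatorics.
  count-ℰ̃ : ∀ {X u} M N T → 0# ≤ u → u ^ 6 ≈ X →
    (∀ n → (n ℕ.≤ M → a * fromℕ n ≤ u ^ 2) × (a * fromℕ n ≤ u ^ 2 → n ℕ.≤ M)) →
    (∀ n → (n ℕ.≤ N → b * fromℕ n ≤ u ^ 3) × (b * fromℕ n ≤ u ^ 3 → n ℕ.≤ N)) →
    (∀ n → (n ℕ.≤ T → a * fromℕ (3 ℕ.* n ℕ.^ 2) ≤ u ^ 2 × b * fromℕ (2 ℕ.* n ℕ.^ 3) ≤ u ^ 3)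
         × (a * fromℕ (3 ℕ.* n ℕ.^ 2) ≤ u ^ 2 → b * fromℕ (2 ℕ.* n ℕ.^ 3) ≤ u ^ 3 → n ℕ.≤ T)) →
    # ℰ̃ ⟨ X ⟩ ℕ.+ suc (2 ℕ.* T) ≡ suc (2 ℕ.* M) ℕ.* suc (2 ℕ.* N)
  count-ℰ̃ {X} {u} M N T 0≤u u⁶≈X M-spec N-spec T-spec = begin
    # ℰ̃ ⟨ X ⟩ ℕ.+ suc (2 ℕ.* T)
      ≡⟨ ≡.cong (# ℰ̃ ⟨ X ⟩ ℕ.+_) (≡.trans (length-map cusp (interval T)) (length-interval T)) ⟨
    length smooth ℕ.+ length singular
      ≡⟨ length-++ smooth ⟨
    length (smooth ++ singular)
      ≡⟨ unique-length both-unique box-unique both⊆box box⊆both ⟩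
    length box
      ≡⟨ length-cartesianProduct (interval M) (interval N) ⟩
    length (interval M) ℕ.* length (interval N)
      ≡⟨ ≡.cong₂ ℕ._*_ (length-interval M) (length-interval N) ⟩
    suc (2 ℕ.* M) ℕ.* suc (2 ℕ.* N) ∎
    where
    open ≡.≡-Reasoning
    smooth = enum (ℰ̃ ⟨ X ⟩) (finite X)
    singular = map cusp (interval T)
    box = cartesianProduct (interval M) (interval N)

    smooth⁻ : ∀ {E} → E ∈ smooth → ℰ̃ E × H E ≤ X
    smooth⁻ = ∈-enum⁻ (ℰ̃ ⟨ X ⟩) (finite X)

    both-unique : Unique (smooth ++ singular)
    both-unique = Unique.++⁺ (enum-unique (ℰ̃ ⟨ X ⟩) (finite X))
      (Unique.map⁺ (λ {s} {t} → cusp-injective {s} {t}) (interval-unique T))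
      λ {E} (E∈smooth , E∈singular) →
        let t , _ , E≡ = ∈-map⁻ cusp {xs = interval T} E∈singular
        in proj₁ (smooth⁻ {E} E∈smooth) (≡.trans (≡.cong Δ E≡) (Δ-cusp t))

    box-unique : Unique box
    box-unique = Unique.cartesianProduct⁺ (interval-unique M) (interval-unique N)

    box⁺ : ∀ {E} → Box u E → E ∈ box
    box⁺ {A , B} (A≤ , B≤) = ∈-cartesianProduct⁺
      (∈-interval⁺ A (proj₂ (M-spec ℤ.∣ A ∣) A≤)) (∈-interval⁺ B (proj₂ (N-spec ℤ.∣ B ∣) B≤))

    box⁻ : ∀ {E} → E ∈ box → Box u E
    box⁻ {A , B} E∈ =
      let A∈ , B∈ = ∈-cartesianProduct⁻ (interval M) (interval N) E∈
      in proj₁ (M-spec ℤ.∣ A ∣) (∈-interval⁻ A A∈) , proj₁ (N-spec ℤ.∣ B ∣) (∈-interval⁻ B B∈)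

    cusp-Box⁺ : ∀ t → ℤ.∣ t ∣ ℕ.≤ T → Box u (cusp t)
    cusp-Box⁺ t t≤T =
      let A≤ , B≤ = proj₁ (T-spec ℤ.∣ t ∣) t≤T
          A≡ , B≡ = ∣cusp∣ t
      in ≡.subst (λ n → a * fromℕ n ≤ u ^ 2) (≡.sym A≡) A≤ ,
         ≡.subst (λ n → b * fromℕ n ≤ u ^ 3) (≡.sym B≡) B≤

    cusp-Box⁻ : ∀ t → Box u (cusp t) → ℤ.∣ t ∣ ℕ.≤ T
    cusp-Box⁻ t (A≤ , B≤) =
      let A≡ , B≡ = ∣cusp∣ t
      in proj₂ (T-spec ℤ.∣ t ∣) (≡.subst (λ n → a * fromℕ n ≤ u ^ 2) A≡ A≤)
                                (≡.subst (λ n → b * fromℕ n ≤ u ^ 3) B≡ B≤)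

    both⊆box : ∀ {E} → E ∈ smooth ++ singular → E ∈ box
    both⊆box {E} E∈ = box⁺ ([ (λ E∈smooth → H≤⇒Box 0≤u u⁶≈X E (proj₂ (smooth⁻ {E} E∈smooth)))
                            , (λ E∈singular → let t , t∈ , E≡ = ∈-map⁻ cusp {xs = interval T} E∈singular
                                in ≡.subst (Box u) (≡.sym E≡) (cusp-Box⁺ t (∈-interval⁻ t t∈))) ]′
                            (∈-++⁻ smooth E∈))

    box⊆both : ∀ {E} → E ∈ box → E ∈ smooth ++ singular
    box⊆both {E} E∈ = by-Δ (Δ E ℤ.≟ + 0)
      where
      by-Δ : Dec (Δ E ≡ + 0) → E ∈ smooth ++ singular
      by-Δ (no Δ≢0)  = ∈-++⁺ˡ (∈-enum⁺ (ℰ̃ ⟨ X ⟩) (finite X) (Δ≢0 , Box⇒H≤ 0≤u u⁶≈X E (box⁻ E∈)))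
      by-Δ (yes Δ≡0) =
        let t , E≡ = singular⇒cusp E Δ≡0
        in ∈-++⁺ʳ smooth (≡.subst (_∈ singular) (≡.sym E≡) (∈-map⁺ cusp
             (∈-interval⁺ t (cusp-Box⁻ t (≡.subst (Box u) E≡ (box⁻ E∈))))))

  module MN = Min totalOrder

  -- The bound |x| ≤ e as two inequalities, a form that adds and negates without case distinctions;
  -- the maximum in `∣_∣` is restored only in the final statement.
  Within : Carrier → Carrier → Set
  Within x e = x ≤ e × - x ≤ e

  within⇒∣∣≤ : ∀ {x e} → Within x e → ∣ x ∣ ≤ e
  within⇒∣∣≤ (x≤e , -x≤e) = MX.⊔-lub x≤e -x≤e

  within-diff : ∀ {x y e} → x ≤ y + e → y ≤ x + e → Within (x - y) e
  within-diff {x} {y} {e} x≤ y≤ = shift x≤ , ≤-resp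
    (solve 2 (λ x y → y :- x := :- (x :- y)) R.refl x y) R.refl (shift y≤)
    where
    shift : ∀ {p q} → p ≤ q + e → p - q ≤ e
    shift {p} {q} h = ≤-resp R.refl (solve 2 (λ q e → (q :+ e) :- q := e) R.refl q e)
      (CompleteOrderedField.+-monoˡ-≤ ℝ (- q) h)

  within-resp : ∀ {x x′ e e′} → x ≈ x′ → e ≈ e′ → Within x e → Within x′ e′
  within-resp p q (h₁ , h₂) = ≤-resp p q h₁ , ≤-resp (R.-‿cong p) q h₂

  within-weaken : ∀ {x d e} → d ≤ e → Within x d → Within x e
  within-weaken d≤e (h₁ , h₂) = O.trans h₁ d≤e , O.trans h₂ d≤e

  within-+ : ∀ {x y d e} → Within x d → Within y e → Within (x + y) (d + e)
  within-+ {x} {y} (x≤ , -x≤) (y≤ , -y≤) = +-mono-≤ x≤ y≤ , ≤-resp (RP.-‿+-comm x y) R.refl (+-mono-≤ -x≤ -y≤)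

  within-neg : ∀ {x e} → Within x e → Within (- x) e
  within-neg {x} (h₁ , h₂) = h₂ , ≤-resp (R.sym (RP.-‿involutive x)) R.refl h₁

  within-nonneg : ∀ {x e} → 0# ≤ x → x ≤ e → Within x e
  within-nonneg 0≤x x≤e = x≤e , O.trans (≤-resp R.refl RP.-0#≈0# (neg-≤ 0≤x)) (O.trans 0≤x x≤e)

  -- Exact count and asymptotics for the nonsingular curves

  √3a ∛2b : Carrier
  √3a = fromℕ 3 ^[ 1 / 2 ] * α ^[ 1 / 6 ]
  ∛2b = fromℕ 2 ^[ 1 / 3 ] * β ^[ 1 / 6 ]

  ^[1/]-nonneg : ∀ k {x} → 0# ≤ x → 0# ≤ x ^[ 1 / suc k ]
  ^[1/]-nonneg k 0≤x = ≤-resp R.refl (R.sym (x^1≈x _)) (root-nonneg k 0≤x)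

  -- This power and the next one explain c: squaring √3a · n ≤ u gives a · 3n² ≤ u², and cubing ∛2b
  -- · n ≤ u gives b · 2n³ ≤ u³, the two conditions for the cusp with |t| = n to lie in the box. The
  -- number c is the smaller reciprocal, so n ≤ c u says both at once.
  √3a-^ : √3a ^ 2 ≈ fromℕ 3 * a
  √3a-^ = R.trans (^-distrib-* _ _ 2) (R.*-cong (^[1/]-^ 1 (0≤fromℕ 3)) (R.sym
    (^[1/]-unique 2 0≤α (^-nonneg 2 0≤α₆) (R.trans (E.^-assocʳ _ 2 3) (^[1/]-^ 5 0≤α)))))
    where
    0≤α₆ = ^[1/]-nonneg 5 0≤α

  ∛2b-^ : ∛2b ^ 3 ≈ fromℕ 2 * b
  ∛2b-^ = R.trans (^-distrib-* _ _ 3) (R.*-cong (^[1/]-^ 2 (0≤fromℕ 2)) (R.sym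
    (^[1/]-unique 1 0≤β (^-nonneg 3 0≤β₆) (R.trans (E.^-assocʳ _ 3 2) (^[1/]-^ 5 0≤β)))))
    where
    0≤β₆ = ^[1/]-nonneg 5 0≤β

  0<√3a : 0# < √3a
  0<√3a = *-pos (1≤⇒0< (1≤^[1/] 1 (1≤fromℕ 2))) (1≤⇒0< (1≤^[1/] 5 1≤α))

  0<∛2b : 0# < ∛2b
  0<∛2b = *-pos (1≤⇒0< (1≤^[1/] 2 (1≤fromℕ 1))) (1≤⇒0< (1≤^[1/] 5 1≤β))

  1/z*u≈u/z : ∀ z u → 1# / z * u ≈ u / z
  1/z*u≈u/z z u = R.trans (R.*-congʳ (R.*-identityˡ (z ⁻¹))) (R.*-comm (z ⁻¹) u)

  ≤c*⇒ : ∀ {x u} → 0# ≤ u → x ≤ c * u → √3a * x ≤ u × ∛2b * x ≤ u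
  ≤c*⇒ {x} {u} 0≤u x≤cu =
    ≤/⇒*≤ 0<√3a (O.trans x≤cu (≤-resp R.refl (1/z*u≈u/z √3a u) (*-monoʳ-≤ 0≤u (MN.x⊓y≤x _ _)))) ,
    ≤/⇒*≤ 0<∛2b (O.trans x≤cu (≤-resp R.refl (1/z*u≈u/z ∛2b u) (*-monoʳ-≤ 0≤u (MN.x⊓y≤y _ _))))

  ⇒≤c* : ∀ {x u} → √3a * x ≤ u → ∛2b * x ≤ u → x ≤ c * u
  ⇒≤c* {x} {u} h₁ h₂ =
    [ (λ c≈ → ≤-resp R.refl (R.sym (R.trans (R.*-congʳ c≈) (1/z*u≈u/z √3a u))) (*≤⇒≤/ 0<√3a h₁))
    , (λ c≈ → ≤-resp R.refl (R.sym (R.trans (R.*-congʳ c≈) (1/z*u≈u/z ∛2b u))) (*≤⇒≤/ 0<∛2b h₂)) ]′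
    (MN.⊓-sel (1# / √3a) (1# / ∛2b))

  scaled-power : ∀ {z q} j l n → z ^ j ≈ fromℕ l * q → (z * fromℕ n) ^ j ≈ q * fromℕ (l ℕ.* n ℕ.^ j)
  scaled-power {z} {q} j l n zʲ≈ = begin
    (z * fromℕ n) ^ j                ≈⟨ ^-distrib-* z (fromℕ n) j ⟩
    z ^ j * fromℕ n ^ j              ≈⟨ R.*-congʳ zʲ≈ ⟩
    fromℕ l * q * fromℕ n ^ j        ≈⟨ solve 3 (λ l q p → l :* q :* p := q :* (l :* p)) R.refl (fromℕ l) q (fromℕ n ^ j) ⟩
    q * (fromℕ l * fromℕ n ^ j)      ≈⟨ R.*-congˡ (R.*-congˡ (fromℕ-^ n j)) ⟨
    q * (fromℕ l * fromℕ (n ℕ.^ j))  ≈⟨ R.*-congˡ (fromℕ-* l (n ℕ.^ j)) ⟨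
    q * fromℕ (l ℕ.* n ℕ.^ j)        ∎
    where open SetoidReasoning R.setoid

  κ : Carrier
  κ = fromℕ 4 / (a * b)

  κab≈4 : κ * (a * b) ≈ fromℕ 4
  κab≈4 = R.trans (R.*-comm κ (a * b)) (*-/-cancel (fromℕ 4) (*-pos 0<a 0<b))

  module Exact {X : Carrier} (0≤X : 0# ≤ X) where
    u v w : Carrier
    u = X ^[ 1 / 6 ]
    v = X ^[ 1 / 3 ]
    w = X ^[ 1 / 2 ]

    0≤u : 0# ≤ u
    0≤u = ^[1/]-nonneg 5 0≤X

    u⁶≈X : u ^ 6 ≈ X
    u⁶≈X = ^[1/]-^ 5 0≤X

    -- The theorem speaks of three separate roots of X; uniqueness of nonnegative roots reduces them
    -- to powers of u.
    v≈u² : v ≈ u ^ 2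
    v≈u² = ^[1/]-unique 2 0≤X (^-nonneg 2 0≤u) (R.trans (E.^-assocʳ u 2 3) u⁶≈X)

    w≈u³ : w ≈ u ^ 3
    w≈u³ = ^[1/]-unique 1 0≤X (^-nonneg 3 0≤u) (R.trans (E.^-assocʳ u 3 2) u⁶≈X)

    0≤c : 0# ≤ c
    0≤c = [ (λ c≈ → ≤-resp R.refl (R.sym c≈) (0≤/ 0≤1 0<√3a)) , (λ c≈ → ≤-resp R.refl (R.sym c≈) (0≤/ 0≤1 0<∛2b)) ]′
      (MN.⊓-sel (1# / √3a) (1# / ∛2b))

    floor-v/a = floor-spec {v / a} (0≤/ (^[1/]-nonneg 2 0≤X) 0<a)
    floor-w/b = floor-spec {w / b} (0≤/ (^[1/]-nonneg 1 0≤X) 0<b)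
    floor-cu  = floor-spec {c * u} (*-nonneg 0≤c 0≤u)

    M N T : ℕ
    M = proj₁ floor-v/a
    N = proj₁ floor-w/b
    T = proj₁ floor-cu

    M≤ : fromℕ M ≤ v / a
    M≤ = proj₁ (proj₂ (proj₂ floor-v/a))
    N≤ : fromℕ N ≤ w / b
    N≤ = proj₁ (proj₂ (proj₂ floor-w/b))
    T≤ : fromℕ T ≤ c * u
    T≤ = proj₁ (proj₂ (proj₂ floor-cu))
    <M+1 : v / a < fromℕ (suc M)
    <M+1 = proj₂ (proj₂ (proj₂ floor-v/a))
    <N+1 : w / b < fromℕ (suc N)
    <N+1 = proj₂ (proj₂ (proj₂ floor-w/b))
    <T+1 : c * u < fromℕ (suc T)
    <T+1 = proj₂ (proj₂ (proj₂ floor-cu))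

    T-upper : ∀ n → n ℕ.≤ T → a * fromℕ (3 ℕ.* n ℕ.^ 2) ≤ u ^ 2 × b * fromℕ (2 ℕ.* n ℕ.^ 3) ≤ u ^ 3
    T-upper n n≤T =
      let h₁ , h₂ = ≤c*⇒ 0≤u (O.trans (fromℕ-mono n≤T) T≤)
      in ≤-resp (scaled-power 2 3 n √3a-^) R.refl (^-mono-≤ 2 (*-nonneg (proj₁ 0<√3a) (0≤fromℕ n)) h₁) ,
         ≤-resp (scaled-power 3 2 n ∛2b-^) R.refl (^-mono-≤ 3 (*-nonneg (proj₁ 0<∛2b) (0≤fromℕ n)) h₂)

    count : # ℰ̃ ⟨ X ⟩ ℕ.+ suc (2 ℕ.* T) ≡ suc (2 ℕ.* M) ℕ.* suc (2 ℕ.* N)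
    count = count-ℰ̃ M N T 0≤u u⁶≈X
      (λ n → (λ n≤M → ≤-resp R.refl v≈u² (≤/⇒*≤ 0<a (O.trans (fromℕ-mono n≤M) M≤))) ,
             (λ h → fromℕ-cancel-≤ (≤-<-trans (*≤⇒≤/ 0<a (≤-resp R.refl (R.sym v≈u²) h)) <M+1)))
      (λ n → (λ n≤N → ≤-resp R.refl w≈u³ (≤/⇒*≤ 0<b (O.trans (fromℕ-mono n≤N) N≤))) ,
             (λ h → fromℕ-cancel-≤ (≤-<-trans (*≤⇒≤/ 0<b (≤-resp R.refl (R.sym w≈u³) h)) <N+1)))
      (λ n → T-upper n ,
             (λ h₁ h₂ → fromℕ-cancel-≤ (≤-<-trans (⇒≤c*
               (^-cancel-≤ 2 0≤u (≤-resp (R.sym (scaled-power 2 3 n √3a-^)) R.refl h₁))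
               (^-cancel-≤ 3 0≤u (≤-resp (R.sym (scaled-power 3 2 n ∛2b-^)) R.refl h₂))) <T+1)))

    formula : + (# ℰ̃ ⟨ X ⟩) ≡ (+ 2 ℤ.* ⌊ v / a ⌋ ℤ.+ + 1) ℤ.* (+ 2 ℤ.* ⌊ w / b ⌋ ℤ.+ + 1) ℤ.- + 2 ℤ.* ⌊ c * u ⌋ ℤ.- + 1
    formula = ≡.trans (rearrange (# ℰ̃ ⟨ X ⟩) count)
      (≡.cong₂ ℤ._-_ (≡.cong₂ ℤ._-_ (≡.cong₂ (λ i j → (+ 2 ℤ.* i ℤ.+ + 1) ℤ.* (+ 2 ℤ.* j ℤ.+ + 1))
        (≡.sym (proj₁ (proj₂ floor-v/a))) (≡.sym (proj₁ (proj₂ floor-w/b))))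
        (≡.cong (+ 2 ℤ.*_) (≡.sym (proj₁ (proj₂ floor-cu))))) ≡.refl)
      where
      open ≡.≡-Reasoning
      open ℤSolver.+-*-Solver using () renaming (solve to solveℤ; _:=_ to _:≡_; _:+_ to _⊕_; _:*_ to _⊗_; _:-_ to _⊝_; con to k)
      odd : ∀ n → + suc (2 ℕ.* n) ≡ + 2 ℤ.* + n ℤ.+ + 1
      odd n = ≡.trans (ℤ.+-comm (+ 1) (+ (2 ℕ.* n))) (≡.cong (ℤ._+ + 1) (ℤ.pos-* 2 n))
      rearrange : ∀ e → e ℕ.+ suc (2 ℕ.* T) ≡ suc (2 ℕ.* M) ℕ.* suc (2 ℕ.* N) →
        + e ≡ (+ 2 ℤ.* + M ℤ.+ + 1) ℤ.* (+ 2 ℤ.* + N ℤ.+ + 1) ℤ.- + 2 ℤ.* + T ℤ.- + 1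
      rearrange e eq = begin
        + e
          ≡⟨ solveℤ 2 (λ e t → e :≡ (e ⊕ (k (+ 2) ⊗ t ⊕ k (+ 1))) ⊝ k (+ 2) ⊗ t ⊝ k (+ 1)) ≡.refl (+ e) (+ T) ⟩
        (+ e ℤ.+ (+ 2 ℤ.* + T ℤ.+ + 1)) ℤ.- + 2 ℤ.* + T ℤ.- + 1
          ≡⟨ ≡.cong (λ i → i ℤ.- + 2 ℤ.* + T ℤ.- + 1) (≡.trans (≡.cong (λ i → + e ℤ.+ i) (≡.sym (odd T)))
               (≡.trans (≡.cong +_ eq) (≡.trans (ℤ.pos-* (suc (2 ℕ.* M)) (suc (2 ℕ.* N))) (≡.cong₂ ℤ._*_ (odd M) (odd N))))) ⟩
        (+ 2 ℤ.* + M ℤ.+ + 1) ℤ.* (+ 2 ℤ.* + N ℤ.+ + 1) ℤ.- + 2 ℤ.* + T ℤ.- + 1 ∎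

    module _ (1≤X : 1# ≤ X) where
      private
        x = v / a
        y = w / b
        m = fromℕ M
        n = fromℕ N
        t = fromℕ T
        f = fromℕ (# ℰ̃ ⟨ X ⟩)

        1≤u : 1# ≤ u
        1≤u = 1≤^[1/] 5 1≤X

        u²≤u³ : u ^ 2 ≤ u ^ 3
        u²≤u³ = ≤-resp (R.*-identityˡ _) R.refl (*-monoʳ-≤ (^-nonneg 2 0≤u) 1≤u)

        ≤-of-multiple : ∀ {γ z q} → 1# ≤ γ → 0# ≤ z → γ * z ≤ q → z ≤ q
        ≤-of-multiple {z = z} 1≤γ 0≤z h = O.trans (≤-resp (R.*-identityˡ z) R.refl (*-monoʳ-≤ 0≤z 1≤γ)) h

        x≤u³ : x ≤ u ^ 3
        x≤u³ = O.trans (≤-of-multiple 1≤a (O.trans (0≤fromℕ M) M≤)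
          (O.reflexive (R.trans (*-/-cancel v 0<a) v≈u²))) u²≤u³

        y≤u³ : y ≤ u ^ 3
        y≤u³ = ≤-of-multiple 1≤b (O.trans (0≤fromℕ N) N≤)
          (O.reflexive (R.trans (*-/-cancel w 0<b) w≈u³))

        -- The bound comes from the cusp with parameter T lying in the box, through T ≤ 3T² ≤ a ·
        -- 3T² ≤ u², rather than from an estimate of c.
        t≤u³ : t ≤ u ^ 3
        t≤u³ = O.trans (O.trans (fromℕ-mono T≤3T²) (≤-of-multiple 1≤a (0≤fromℕ (3 ℕ.* T ℕ.^ 2)) (proj₁ (T-upper T ℕ.≤-refl)))) u²≤u³
          where
          T≤3T² : T ℕ.≤ 3 ℕ.* T ℕ.^ 2
          T≤3T² = ℕ.≤-trans (n≤n^ T 1) (ℕ.m≤n*m (T ℕ.^ 2) 3)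

        1≤u³ : 1# ≤ u ^ 3
        1≤u³ = 1≤^ 3 1≤u

        f-eq : f + (1# + fromℕ 2 * t) ≈ (1# + fromℕ 2 * m) * (1# + fromℕ 2 * n)
        f-eq = begin
          f + (1# + fromℕ 2 * t)                             ≈⟨ R.+-congˡ (odd T) ⟨
          f + fromℕ (suc (2 ℕ.* T))                          ≈⟨ fromℕ-+ (# ℰ̃ ⟨ X ⟩) (suc (2 ℕ.* T)) ⟨
          fromℕ (# ℰ̃ ⟨ X ⟩ ℕ.+ suc (2 ℕ.* T))               ≡⟨ ≡.cong fromℕ count ⟩
          fromℕ (suc (2 ℕ.* M) ℕ.* suc (2 ℕ.* N))            ≈⟨ fromℕ-* (suc (2 ℕ.* M)) (suc (2 ℕ.* N)) ⟩
          fromℕ (suc (2 ℕ.* M)) * fromℕ (suc (2 ℕ.* N))      ≈⟨ R.*-cong (odd M) (odd N) ⟩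
          (1# + fromℕ 2 * m) * (1# + fromℕ 2 * n)            ∎
          where
          open SetoidReasoning R.setoid
          odd : ∀ k → fromℕ (suc (2 ℕ.* k)) ≈ 1# + fromℕ 2 * fromℕ k
          odd k = R.+-congˡ (fromℕ-* 2 k)

        main-eq : κ * u ^ 5 ≈ fromℕ 4 * (x * y)
        main-eq = begin
          κ * u ^ 5                     ≈⟨ R.*-congˡ (E.^-homo-* u 2 3) ⟩
          κ * (u ^ 2 * u ^ 3)           ≈⟨ R.*-congˡ (R.*-cong v≈u² w≈u³) ⟨
          κ * (v * w)                   ≈⟨ R.*-congˡ (R.*-cong (*-/-cancel v 0<a) (*-/-cancel w 0<b)) ⟨
          κ * (a * x * (b * y))
            ≈⟨ solve 5 (λ k a b x y → k :* (a :* x :* (b :* y)) := k :* (a :* b) :* (x :* y)) R.refl κ a b x y ⟩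
          κ * (a * b) * (x * y)         ≈⟨ R.*-congʳ κab≈4 ⟩
          fromℕ 4 * (x * y)             ∎
          where open SetoidReasoning R.setoid

        0≤m = 0≤fromℕ M
        0≤n = 0≤fromℕ N
        0≤t = 0≤fromℕ T
        0≤2t = *-nonneg (0≤fromℕ 2) 0≤t

        1+2-mono : ∀ {p q} → p ≤ q → 1# + fromℕ 2 * p ≤ 1# + fromℕ 2 * q
        1+2-mono h = +-monoʳ-≤ 1# (*-monoˡ-≤ (0≤fromℕ 2) h)

        f-upper : f ≤ κ * u ^ 5 + fromℕ 10 * u ^ 3
        f-upper = begin
          f
            ≈⟨ solve 2 (λ f t → f := (f :+ (:1 :+ con (+ 2) :* t)) :- (:1 :+ con (+ 2) :* t)) R.refl f t ⟩
          (f + (1# + fromℕ 2 * t)) - (1# + fromℕ 2 * t)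
            ≤⟨ +-mono-≤ (O.reflexive f-eq) (neg-≤ (≤-resp (R.+-identityʳ 1#) R.refl (+-monoʳ-≤ 1# 0≤2t))) ⟩
          (1# + fromℕ 2 * m) * (1# + fromℕ 2 * n) - 1#
            ≤⟨ CompleteOrderedField.+-monoˡ-≤ ℝ (- 1#) (*-mono-≤ (+-nonneg 0≤1 (*-nonneg (0≤fromℕ 2) 0≤m))
                 (O.trans (+-nonneg 0≤1 (*-nonneg (0≤fromℕ 2) 0≤n)) (1+2-mono N≤)) (1+2-mono M≤) (1+2-mono N≤)) ⟩
          (1# + fromℕ 2 * x) * (1# + fromℕ 2 * y) - 1#
            ≈⟨ solve 2 (λ x y → (:1 :+ con (+ 2) :* x) :* (:1 :+ con (+ 2) :* y) :- :1
                 := con (+ 4) :* (x :* y) :+ con (+ 2) :* (x :+ y)) R.refl x y ⟩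
          fromℕ 4 * (x * y) + fromℕ 2 * (x + y)
            ≤⟨ +-mono-≤ (O.reflexive (R.sym main-eq)) (*-monoˡ-≤ (0≤fromℕ 2) (+-mono-≤ x≤u³ y≤u³)) ⟩
          κ * u ^ 5 + fromℕ 2 * (u ^ 3 + u ^ 3)
            -- The upper estimate produces only 4u³; adding 6u³ gives it the same constant as the
            -- lower one.
            ≤⟨ +-monoʳ-≤ _ (≤-resp (R.trans (R.+-identityʳ _)
                 (solve 1 (λ s → con (+ 4) :* s := con (+ 2) :* (s :+ s)) R.refl (u ^ 3)))
                 (solve 1 (λ s → con (+ 4) :* s :+ con (+ 6) :* s := con (+ 10) :* s) R.refl (u ^ 3))
                 (+-monoʳ-≤ (fromℕ 4 * u ^ 3) (*-nonneg (0≤fromℕ 6) (^-nonneg 3 0≤u)))) ⟩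
          κ * u ^ 5 + fromℕ 10 * u ^ 3 ∎
          where open ≤-Reasoning

        -- The constant 10 = 4 + 2 + 2 + 2 arises here: replacing x and y by m + 1 and n + 1 and
        -- restoring the singular curves costs 4 + 2t + 2m + 2n, and each of 1, t, m, n is at most
        -- u³ because u ≥ 1.
        f-lower : κ * u ^ 5 ≤ f + fromℕ 10 * u ^ 3
        f-lower = begin
          κ * u ^ 5
            ≈⟨ main-eq ⟩
          fromℕ 4 * (x * y)
            ≤⟨ *-monoˡ-≤ (0≤fromℕ 4) (*-mono-≤ (O.trans 0≤m M≤) (O.trans (O.trans 0≤n N≤) (proj₁ <N+1)) (proj₁ <M+1) (proj₁ <N+1)) ⟩
          fromℕ 4 * ((1# + m) * (1# + n))
            ≈⟨ solve 2 (λ m n → con (+ 4) :* ((:1 :+ m) :* (:1 :+ n))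
                 := (:1 :+ con (+ 2) :* m) :* (:1 :+ con (+ 2) :* n) :+ (con (+ 3) :* :1 :+ con (+ 2) :* m :+ con (+ 2) :* n)) R.refl m n ⟩
          (1# + fromℕ 2 * m) * (1# + fromℕ 2 * n) + (fromℕ 3 * 1# + fromℕ 2 * m + fromℕ 2 * n)
            ≈⟨ R.+-congʳ f-eq ⟨
          f + (1# + fromℕ 2 * t) + (fromℕ 3 * 1# + fromℕ 2 * m + fromℕ 2 * n)
            ≈⟨ solve 4 (λ f t m n → f :+ (:1 :+ con (+ 2) :* t) :+ (con (+ 3) :* :1 :+ con (+ 2) :* m :+ con (+ 2) :* n)
                 := f :+ (con (+ 4) :* :1 :+ con (+ 2) :* t :+ con (+ 2) :* m :+ con (+ 2) :* n)) R.refl f t m n ⟩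
          f + (fromℕ 4 * 1# + fromℕ 2 * t + fromℕ 2 * m + fromℕ 2 * n)
            ≤⟨ +-monoʳ-≤ f (+-mono-≤ (+-mono-≤ (+-mono-≤ (*-monoˡ-≤ (0≤fromℕ 4) 1≤u³) (*-monoˡ-≤ (0≤fromℕ 2) t≤u³))
                 (*-monoˡ-≤ (0≤fromℕ 2) (O.trans M≤ x≤u³))) (*-monoˡ-≤ (0≤fromℕ 2) (O.trans N≤ y≤u³))) ⟩
          f + (fromℕ 4 * u ^ 3 + fromℕ 2 * u ^ 3 + fromℕ 2 * u ^ 3 + fromℕ 2 * u ^ 3)
            ≈⟨ R.+-congˡ (solve 1 (λ s → con (+ 4) :* s :+ con (+ 2) :* s :+ con (+ 2) :* s :+ con (+ 2) :* s := con (+ 10) :* s) R.refl (u ^ 3)) ⟩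
          f + fromℕ 10 * u ^ 3 ∎
          where open ≤-Reasoning

      ℰ̃-estimate : Within (fromℕ (# ℰ̃ ⟨ X ⟩) - κ * u ^ 5) (fromℕ 10 * u ^ 3)
      ℰ̃-estimate = within-diff f-upper f-lower

  ℰ̃-asymptotic : ∀ {X} → 0# ≤ X → 1# ≤ X →
    Within (fromℕ (# ℰ̃ ⟨ X ⟩) - κ * X ^[ 5 / 6 ]) (fromℕ 10 * X ^[ 1 / 2 ])
  ℰ̃-asymptotic 0≤X 1≤X = within-resp (R.+-congˡ (R.-‿cong (R.*-congˡ (E.^-congˡ 5 (x^1≈x _)))))
    (R.*-congˡ (R.sym (Exact.w≈u³ 0≤X))) (Exact.ℰ̃-estimate 0≤X 1≤X)

  ℰ̃-bound : ∀ {u X} → 1# ≤ u → u ^ 6 ≈ X → Within (fromℕ (# ℰ̃ ⟨ X ⟩) - κ * u ^ 5) (fromℕ 10 * u ^ 3)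
  ℰ̃-bound {u} {X} 1≤u u⁶≈X = within-resp (R.+-congˡ (R.-‿cong (R.*-congˡ (E.^-congˡ 5 root≈u)))) (R.*-congˡ (E.^-congˡ 3 root≈u))
    (Exact.ℰ̃-estimate (O.trans 0≤1 1≤X) 1≤X)
    where
    1≤X : 1# ≤ X
    1≤X = ≤-resp R.refl u⁶≈X (1≤^ 6 1≤u)
    root≈u : X ^[ 1 / 6 ] ≈ u
    root≈u = ^[1/]-unique 5 (O.trans 0≤1 1≤X) (O.trans 0≤1 1≤u) u⁶≈X

  -- The scaling factors d ≥ 1 are indexed by d − 1.
  recip : ℕ → Carrier
  recip d = fromℕ (suc d) ⁻¹

  -- Scaling by d multiplies A by d⁴ and B by d⁶. Against the bounds u² and u³ both amount to
  -- replacing u by u/d², which is what makes one real parameter suffice.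
  shrink : ℕ → Carrier → Carrier
  shrink d u = u * recip d ^ 2

  shrink-nonneg : ∀ d {u} → 0# ≤ u → 0# ≤ shrink d u
  shrink-nonneg d 0≤u = *-nonneg 0≤u (^-nonneg 2 (Inv.0≤N⁻¹ d))

  shrink-^ : ∀ d u j → shrink d u ^ j ≈ u ^ j * recip d ^ (2 ℕ.* j)
  shrink-^ d u j = R.trans (^-distrib-* u (recip d ^ 2) j) (R.*-congˡ (E.^-assocʳ (recip d) 2 j))

  module _ {u : Carrier} (d : ℕ) where
    private
      module I = Inv d
      N r : Carrier
      N = fromℕ (suc d)
      r = recip d

      term : ∀ q n k → q * fromℕ (suc d ℕ.^ k ℕ.* n) ≈ N ^ k * (q * fromℕ n)
      term q n k = begin
        q * fromℕ (suc d ℕ.^ k ℕ.* n)          ≈⟨ R.*-congˡ (fromℕ-* (suc d ℕ.^ k) n) ⟩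
        q * (fromℕ (suc d ℕ.^ k) * fromℕ n)    ≈⟨ R.*-congˡ (R.*-congʳ (fromℕ-^ (suc d) k)) ⟩
        q * (N ^ k * fromℕ n)
          ≈⟨ solve 3 (λ q p n → q :* (p :* n) := p :* (q :* n)) R.refl q (N ^ k) (fromℕ n) ⟩
        N ^ k * (q * fromℕ n) ∎
        where open SetoidReasoning R.setoid

      cancel-N : ∀ k p → N ^ k * p * r ^ k ≈ p
      cancel-N k p = R.trans (solve 3 (λ x p y → x :* p :* y := x :* y :* p) R.refl (N ^ k) p (r ^ k))
        (R.trans (R.*-congʳ (I.^-inverse k)) (R.*-identityˡ p))

      restore-N : ∀ k p → N ^ k * (p * r ^ k) ≈ p
      restore-N k p = R.trans (R.sym (R.*-assoc _ _ _)) (cancel-N k p)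

      scale-bound⁺ : ∀ q n j → q * fromℕ n ≤ shrink d u ^ j → q * fromℕ (suc d ℕ.^ (2 ℕ.* j) ℕ.* n) ≤ u ^ j
      scale-bound⁺ q n j h = ≤-resp (R.sym (term q n k))
        (R.trans (R.*-congˡ (shrink-^ d u j)) (restore-N k (u ^ j))) (*-monoˡ-≤ (^-nonneg k (0≤fromℕ (suc d))) h)
        where k = 2 ℕ.* j

      scale-bound⁻ : ∀ q n j → q * fromℕ (suc d ℕ.^ (2 ℕ.* j) ℕ.* n) ≤ u ^ j → q * fromℕ n ≤ shrink d u ^ j
      scale-bound⁻ q n j h = ≤-resp (R.trans (R.*-congʳ (term q n k)) (cancel-N k _)) (R.sym (shrink-^ d u j))
        (*-monoʳ-≤ (^-nonneg k I.0≤N⁻¹) h)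
        where k = 2 ℕ.* j

    Box-scale⁺ : ∀ E → Box (shrink d u) E → Box u (scale (suc d) E)
    Box-scale⁺ (A , B) (A≤ , B≤) =
      ≡.subst (λ n → a * fromℕ n ≤ u ^ 2) (≡.sym (∣scale∣ (suc d ℕ.^ 4) A)) (scale-bound⁺ a ℤ.∣ A ∣ 2 A≤) ,
      ≡.subst (λ n → b * fromℕ n ≤ u ^ 3) (≡.sym (∣scale∣ (suc d ℕ.^ 6) B)) (scale-bound⁺ b ℤ.∣ B ∣ 3 B≤)

    Box-scale⁻ : ∀ E → Box u (scale (suc d) E) → Box (shrink d u) E
    Box-scale⁻ (A , B) (A≤ , B≤) =
      scale-bound⁻ a ℤ.∣ A ∣ 2 (≡.subst (λ n → a * fromℕ n ≤ u ^ 2) (∣scale∣ (suc d ℕ.^ 4) A) A≤) ,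
      scale-bound⁻ b ℤ.∣ B ∣ 3 (≡.subst (λ n → b * fromℕ n ≤ u ^ 3) (∣scale∣ (suc d ℕ.^ 6) B) B≤)

  n≤q*n : ∀ {q} → 1# ≤ q → ∀ n → fromℕ n ≤ q * fromℕ n
  n≤q*n 1≤q n = ≤-resp (R.*-identityˡ _) R.refl (*-monoʳ-≤ (0≤fromℕ n) 1≤q)

  Box-size : ∀ {u} E → Box u E → fromℕ (size E) ≤ u ^ 2 + u ^ 3
  Box-size (A , B) (A≤ , B≤) = ≤-resp (R.sym (fromℕ-+ ℤ.∣ A ∣ ℤ.∣ B ∣)) R.refl
    (+-mono-≤ (O.trans (n≤q*n 1≤a ℤ.∣ A ∣) A≤) (O.trans (n≤q*n 1≤b ℤ.∣ B ∣) B≤))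

  -- Finite sums

  ∑-cong : ∀ n {f g : ℕ → Carrier} → (∀ d → f d ≈ g d) → (∑< n) f ≈ (∑< n) g
  ∑-cong zero    f≈g = R.refl
  ∑-cong (suc n) f≈g = R.+-cong (∑-cong n f≈g) (f≈g n)

  ∑-+ : ∀ n (f g : ℕ → Carrier) → (∑< n) (λ d → f d + g d) ≈ (∑< n) f + (∑< n) g
  ∑-+ zero    f g = R.sym (R.+-identityʳ 0#)
  ∑-+ (suc n) f g = R.trans (R.+-congʳ (∑-+ n f g))
    (solve 4 (λ p q r s → p :+ q :+ (r :+ s) := p :+ r :+ (q :+ s)) R.refl ((∑< n) f) ((∑< n) g) (f n) (g n))

  ∑-*ˡ : ∀ n x (f : ℕ → Carrier) → (∑< n) (λ d → x * f d) ≈ x * (∑< n) f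
  ∑-*ˡ zero    x f = R.sym (R.zeroʳ x)
  ∑-*ˡ (suc n) x f = R.trans (R.+-congʳ (∑-*ˡ n x f)) (R.sym (R.distribˡ x _ _))

  ∑-head : ∀ n (f : ℕ → Carrier) → (∑< suc n) f ≈ f 0 + (∑< n) (λ d → f (suc d))
  ∑-head zero    f = R.+-comm 0# (f 0)
  ∑-head (suc n) f = R.trans (R.+-congʳ (∑-head n f)) (R.+-assoc _ _ _)

  ∑-mono-≤ : ∀ n {f g : ℕ → Carrier} → (∀ d → f d ≤ g d) → (∑< n) f ≤ (∑< n) g
  ∑-mono-≤ zero    f≤g = O.refl
  ∑-mono-≤ (suc n) f≤g = +-mono-≤ (∑-mono-≤ n f≤g) (f≤g n)

  within-∑ : ∀ n {f g : ℕ → Carrier} → (∀ d → Within (f d) (g d)) → Within ((∑< n) f) ((∑< n) g)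
  within-∑ zero    h = within-nonneg O.refl O.refl
  within-∑ (suc n) h = within-+ (within-∑ n h) (h n)

  -- Decomposition of the nonsingular curves by their minimal models

  #ℰ : Carrier → ℕ
  #ℰ u = # ℰ ⟨ u ^ 6 ⟩

  #ℰ-cong : ∀ {u v} → u ≈ v → #ℰ u ≡ #ℰ v
  #ℰ-cong u≈v = #-cong ℰ (E.^-congˡ 6 u≈v)

  module _ {u : Carrier} (0≤u : 0# ≤ u) where
    private
      models : ℕ → List Curve
      models d = enum (ℰ ⟨ shrink d u ^ 6 ⟩) (finite (shrink d u ^ 6))

      scaled : ℕ → List Curve
      scaled zero    = []
      scaled (suc n) = scaled n ++ map (scale (suc n)) (models n)

      model⁻ : ∀ d {E} → E ∈ models d → ℰ E × H E ≤ shrink d u ^ 6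
      model⁻ d = ∈-enum⁻ (ℰ ⟨ shrink d u ^ 6 ⟩) (finite (shrink d u ^ 6))

      scaled⁻ : ∀ n {E} → E ∈ scaled n → ∃[ d ] ∃[ E′ ] d ℕ.< n × E′ ∈ models d × E ≡ scale (suc d) E′
      scaled⁻ (suc n) {E} E∈ =
        [ (λ E∈ → let d , E′ , d<n , E′∈ , E≡ = scaled⁻ n E∈ in d , E′ , ℕ.m<n⇒m<1+n d<n , E′∈ , E≡)
        , (λ E∈ → let E′ , E′∈ , E≡ = ∈-map⁻ (scale (suc n)) {xs = models n} E∈ in n , E′ , ℕ.≤-refl , E′∈ , E≡)
        ]′ (∈-++⁻ (scaled n) E∈)

      scaled⁺ : ∀ n {d E} → d ℕ.< n → E ∈ models d → scale (suc d) E ∈ scaled n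
      scaled⁺ (suc n) {d} {E} d<1+n E∈ =
        [ (λ d<n → ∈-++⁺ˡ (scaled⁺ n d<n E∈))
        , (λ { ≡.refl → ∈-++⁺ʳ (scaled n) (∈-map⁺ (scale (suc n)) E∈) })
        ]′ (ℕ.m≤n⇒m<n∨m≡n (ℕ.s≤s⁻¹ d<1+n))

      minimal : ∀ d {E} → E ∈ models d → Minimal E
      minimal d {E} E∈ = proj₂ (proj₁ (model⁻ d {E} E∈))

      -- Inside a block scaling by a fixed factor is injective; two different blocks are disjoint
      -- because a curve determines the factor of its minimal model.
      scaled-unique : ∀ n → Unique (scaled n)
      scaled-unique zero    = AllPairs.[]
      scaled-unique (suc n) = Unique.++⁺ (scaled-unique n)
        (Unique.map⁺ (λ {E} {E′} → scale-injective n {E} {E′})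
          (enum-unique (ℰ ⟨ shrink n u ^ 6 ⟩) (finite (shrink n u ^ 6))))
        λ {E} (E∈₁ , E∈₂) →
          let d , E₁ , d<n , E₁∈ , E≡₁ = scaled⁻ n {E} E∈₁
              E₂ , E₂∈ , E≡₂ = ∈-map⁻ (scale (suc n)) {xs = models n} E∈₂
          in ℕ.<⇒≢ d<n 
            (scale-factor-unique {d} {n} {E₁} {E₂} (minimal d {E₁} E₁∈) (minimal n {E₂} E₂∈) (≡.trans (≡.sym E≡₁) E≡₂))

      length-scaled : ∀ n → fromℕ (length (scaled n)) ≈ (∑< n) (λ d → fromℕ (#ℰ (shrink d u)))
      length-scaled zero    = R.refl
      length-scaled (suc n) = begin
        fromℕ (length (scaled n ++ map (scale (suc n)) (models n)))
          ≡⟨ ≡.cong fromℕ (≡.trans (length-++ (scaled n)) (≡.cong (length (scaled n) ℕ.+_) (length-map (scale (suc n)) (models n)))) ⟩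
        fromℕ (length (scaled n) ℕ.+ length (models n))
          ≈⟨ fromℕ-+ (length (scaled n)) (length (models n)) ⟩
        fromℕ (length (scaled n)) + fromℕ (#ℰ (shrink n u))
          ≈⟨ R.+-congʳ (length-scaled n) ⟩
        (∑< n) (λ d → fromℕ (#ℰ (shrink d u))) + fromℕ (#ℰ (shrink n u)) ∎
        where open SetoidReasoning R.setoid

    -- Stopping at n loses nothing: a minimal model E′ has positive size, so the factor is at most
    -- the size of the scaled curve, which the box bounds by u² + u³. Every larger n works as well,
    -- which leaves room to push n further out for the sake of `ζ 10`.
    ℰ̃-decomposition : ∀ n → u ^ 2 + u ^ 3 < fromℕ (suc n) →
      fromℕ (# ℰ̃ ⟨ u ^ 6 ⟩) ≈ (∑< n) (λ d → fromℕ (#ℰ (shrink d u)))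
    ℰ̃-decomposition n size<1+n = R.trans
      (R.reflexive (≡.cong fromℕ (unique-length (enum-unique (ℰ̃ ⟨ u ^ 6 ⟩) (finite (u ^ 6))) (scaled-unique n) ⊆ ⊇)))
      (length-scaled n)
      where
      ⊆ : ∀ {E} → E ∈ enum (ℰ̃ ⟨ u ^ 6 ⟩) (finite (u ^ 6)) → E ∈ scaled n
      ⊆ {E} E∈ = ≡.subst (_∈ scaled n) (≡.sym E≡) (scaled⁺ n d<n
        (∈-enum⁺ (ℰ ⟨ shrink d u ^ 6 ⟩) (finite (shrink d u ^ 6))
          (E′∈ℰ , Box⇒H≤ (shrink-nonneg d 0≤u) R.refl E′ (Box-scale⁻ d E′ E-Box))))
        where
        E∈ℰ̃ = ∈-enum⁻ (ℰ̃ ⟨ u ^ 6 ⟩) (finite (u ^ 6)) {E} E∈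
        model = minimal-model em E (proj₁ E∈ℰ̃)
        d = proj₁ model
        E′ = proj₁ (proj₂ model)
        E′∈ℰ : ℰ E′
        E′∈ℰ = proj₁ (proj₂ (proj₂ model))
        E≡ : E ≡ scale (suc d) E′
        E≡ = proj₂ (proj₂ (proj₂ model))
        E-Box : Box u (scale (suc d) E′)
        E-Box = ≡.subst (Box u) E≡ (H≤⇒Box 0≤u R.refl E (proj₂ E∈ℰ̃))
        d<n : d ℕ.< n
        d<n = ℕ.≤-trans (ℕ.m≤m*n (suc d) (size E′) {{ℕ.>-nonZero (0<size E′ (proj₁ E′∈ℰ))}})
          (ℕ.≤-trans (d*size≤size-scale (suc d) E′)
            (fromℕ-cancel-≤ (≤-<-trans (Box-size (scale (suc d) E′) E-Box) size<1+n)))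
      ⊇ : ∀ {E} → E ∈ scaled n → E ∈ enum (ℰ̃ ⟨ u ^ 6 ⟩) (finite (u ^ 6))
      ⊇ {E} E∈ =
        let d , E′ , _ , E′∈ , E≡ = scaled⁻ n {E} E∈
            E′∈ℰ , H≤ = model⁻ d {E′} E′∈
        in ∈-enum⁺ (ℰ̃ ⟨ u ^ 6 ⟩) (finite (u ^ 6))
          (≡.subst ℰ̃ (≡.sym E≡) (ℰ̃-scale (suc d) E′ (λ ()) (proj₁ E′∈ℰ)) ,
           Box⇒H≤ 0≤u R.refl E (≡.subst (Box u) (≡.sym E≡)
             (Box-scale⁺ d E′ (H≤⇒Box (shrink-nonneg d 0≤u) R.refl E′ H≤))))

  -- The leading constant and sums of reciprocal powers

  κ′ : Carrier
  κ′ = fromℕ 4 / (a * b * ζ 10)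

  recip-0 : recip 0 ≈ 1#
  recip-0 = R.trans (R.sym (R.trans (R.*-congʳ (R.+-identityʳ 1#)) (R.*-identityˡ _))) (Inv.inverse 0)

  ζ-term-0 : ∀ s → ζ-term s 0 ≈ 1#
  ζ-term-0 s = R.trans (Inv.^-⁻¹ 0 s) (R.trans (E.^-congˡ s recip-0) (1^n s))

  1≤ζ : 1# ≤ ζ 10
  1≤ζ = ≤-resp (R.trans (R.+-identityˡ _) (ζ-term-0 10)) R.refl (ζ-Convergence.S≤z 8 1)

  0<abζ : 0# < a * b * ζ 10
  0<abζ = *-pos (*-pos 0<a 0<b) (1≤⇒0< 1≤ζ)

  0≤κ′ : 0# ≤ κ′
  0≤κ′ = 0≤/ (0≤fromℕ 4) 0<abζ

  κ′ζ≈κ : κ′ * ζ 10 ≈ κ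
  κ′ζ≈κ = *-cancelˡ-≈ (*-pos 0<a 0<b) (begin
    a * b * (κ′ * ζ 10)  ≈⟨ solve 4 (λ a b k z → a :* b :* (k :* z) := a :* b :* z :* k) R.refl a b κ′ (ζ 10) ⟩
    a * b * ζ 10 * κ′    ≈⟨ *-/-cancel (fromℕ 4) 0<abζ ⟩
    fromℕ 4              ≈⟨ *-/-cancel (fromℕ 4) (*-pos 0<a 0<b) ⟨
    a * b * κ            ∎)
    where open SetoidReasoning R.setoid

  half : Carrier
  half = recip 1

  recip≤half : ∀ d → recip (suc d) ≤ half
  recip≤half d = ≤-resp
    (R.trans (R.*-assoc _ _ _) (R.trans (R.*-congˡ (Inv.inverse 1)) (R.*-identityʳ _)))
    (R.trans (R.*-congʳ (R.trans (R.*-comm _ _) (Inv.inverse (suc d)))) (R.*-identityˡ _))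
    (*-monoʳ-≤ (Inv.0≤N⁻¹ 1) (*-monoˡ-≤ (Inv.0≤N⁻¹ (suc d)) (fromℕ-mono {2} {suc (suc d)} (s≤s (s≤s z≤n)))))

  -- The partial sums of ζ(5) are at most 2, and their first term is 1.
  ∑-recip⁵≤1 : ∀ n → (∑< n) (λ d → recip (suc d) ^ 5) ≤ 1#
  ∑-recip⁵≤1 n = ≤-resp (solve 1 (λ s → (:1 :+ s) :- :1 := s) R.refl _) (solve 0 ((:1 :+ :1) :- :1 := :1) R.refl)
    (CompleteOrderedField.+-monoˡ-≤ ℝ (- 1#) (≤-resp
      (R.trans (∑-head n (ζ-term 5)) (R.+-cong (ζ-term-0 5) (∑-cong n (λ d → Inv.^-⁻¹ (suc d) 5)))) R.refl
      (ζ-Convergence.S≤2 3 (suc n))))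

  -- One factor 1/d ≤ 1/2 is split off and the bound for exponent 5 is applied to the rest. The same
  -- general bound 2 used directly at exponent 6 would give only 1.
  ∑-recip⁶≤half : ∀ n → (∑< n) (λ d → recip (suc d) ^ 6) ≤ half
  ∑-recip⁶≤half n = O.trans
    (∑-mono-≤ n (λ d → *-monoʳ-≤ (^-nonneg 5 (Inv.0≤N⁻¹ (suc d))) (recip≤half d)))
    (≤-resp (R.sym (∑-*ˡ n half _)) (R.*-identityʳ half) (*-monoˡ-≤ (Inv.0≤N⁻¹ 1) (∑-recip⁵≤1 n)))

  shrink-suc≤ : ∀ d {u} → 0# ≤ u → shrink (suc d) u ≤ u * half
  shrink-suc≤ d 0≤u = *-monoˡ-≤ 0≤u (O.trans
    (≤-resp R.refl (R.*-identityʳ _) (*-monoˡ-≤ (Inv.0≤N⁻¹ (suc d)) (^≤1 1 (Inv.0≤N⁻¹ (suc d)) (Inv.N⁻¹≤1 (suc d)))))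
    (recip≤half d))

  -- For d ≥ 2 the argument is at least halved, and 2(n + 1) ≥ n + 2. An integer bound on u thus
  -- drops by one, which drives the induction in `error-bound`.
  shrink-suc< : ∀ d {u} n → 0# ≤ u → u < fromℕ (suc (suc n)) → shrink (suc d) u < fromℕ (suc n)
  shrink-suc< d {u} n 0≤u u<2+n = ≰⇒> λ 1+n≤ → <⇒≱ u<2+n (begin
    fromℕ (suc (suc n))         ≤⟨ fromℕ-mono (s≤s (ℕ.m≤n+m (suc n) n)) ⟩
    fromℕ (suc n ℕ.+ suc n)     ≈⟨ fromℕ-+ (suc n) (suc n) ⟩
    fromℕ (suc n) + fromℕ (suc n)
      ≤⟨ +-mono-≤ (O.trans 1+n≤ (shrink-suc≤ d 0≤u)) (O.trans 1+n≤ (shrink-suc≤ d 0≤u)) ⟩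
    u * half + u * half         ≈⟨ solve 2 (λ u h → u :* h :+ u :* h := u :* (con (+ 2) :* h)) R.refl u half ⟩
    u * (fromℕ 2 * half)        ≈⟨ R.*-congˡ (Inv.inverse 1) ⟩
    u * 1#                      ≈⟨ R.*-identityʳ u ⟩
    u                           ∎)
    where open ≤-Reasoning

  -- For u < 1 the only lattice point in the box is (0 , 0), which is singular.
  #ℰ-small : ∀ {u} → 0# ≤ u → u < 1# → #ℰ u ≡ 0
  #ℰ-small {u} 0≤u u<1 = unique-length (enum-unique (ℰ ⟨ u ^ 6 ⟩) (finite (u ^ 6))) AllPairs.[]
    (λ {E} E∈ → ⊥-elim (empty E (∈-enum⁻ (ℰ ⟨ u ^ 6 ⟩) (finite (u ^ 6)) {E} E∈))) (λ ())
    where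
    vanish : ∀ {q} n k → 1# ≤ q → q * fromℕ n ≤ u ^ suc k → n ≡ 0
    vanish n k 1≤q h = ℕ.n≤0⇒n≡0 (fromℕ-cancel-≤ (≤-<-trans (O.trans (n≤q*n 1≤q n) (O.trans h
      (≤-resp R.refl (R.*-identityʳ u) (*-monoˡ-≤ 0≤u (^≤1 k 0≤u (proj₁ u<1))))))
      (<-resp R.refl (R.sym (R.+-identityʳ 1#)) u<1)))
    empty : ∀ E → ¬ (ℰ E × H E ≤ u ^ 6)
    empty E@(A , B) (E∈ℰ , H≤) =
      let A≤ , B≤ = H≤⇒Box 0≤u R.refl E H≤
      in ℕ.<⇒≢ (0<size E (proj₁ E∈ℰ)) (≡.sym (≡.cong₂ ℕ._+_ (vanish ℤ.∣ A ∣ 1 1≤a A≤) (vanish ℤ.∣ B ∣ 2 1≤b B≤)))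

  -- The error term for the minimal models

  error : Carrier → Carrier
  error u = fromℕ (#ℰ u) - κ′ * u ^ 5

  error-cong : ∀ {u v} → u ≈ v → error u ≈ error v
  error-cong u≈v = R.+-cong (R.reflexive (≡.cong fromℕ (#ℰ-cong u≈v))) (R.-‿cong (R.*-congˡ (E.^-congˡ 5 u≈v)))

  -- Chosen so that 11 + K/2 = 22 + κ′ ≤ K, where 11 is the constant 10 for ℰ̃ plus 1 for the tail
  -- of the zeta series, and so that κ′ ≤ K, which settles u < 1.
  K : Carrier
  K = fromℕ 2 * (fromℕ 11 + κ′)

  0≤K : 0# ≤ K
  0≤K = *-nonneg (0≤fromℕ 2) (+-nonneg (0≤fromℕ 11) 0≤κ′)

  S : ℕ → Carrier
  S n = (∑< n) (ζ-term 10)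

  -- In the decomposition each count is written as error plus main term, and the term with factor 1,
  -- which is `error u`, is solved for. The main terms sum to κ′u⁵ times a partial sum of ζ(10),
  -- while κu⁵ needs the full value; the middle summand is this discrepancy.
  error-recursion : ∀ {u} n → 0# ≤ u → u ^ 2 + u ^ 3 < fromℕ (suc (suc n)) →
    error u ≈ (fromℕ (# ℰ̃ ⟨ u ^ 6 ⟩) - κ * u ^ 5) + κ′ * u ^ 5 * (ζ 10 - S (suc n))
              - (∑< n) (λ d → error (shrink (suc d) u))
  error-recursion {u} n 0≤u large = begin
    error u
      ≈⟨ solve 3 (λ e t s → e := (e :+ t :+ s) :- s :- t) R.refl (error u) tail (κ′ * u ^ 5 * S (suc n)) ⟩
    (error u + tail + κ′ * u ^ 5 * S (suc n)) - κ′ * u ^ 5 * S (suc n) - tail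
      ≈⟨ R.+-congʳ (R.+-congʳ F≈) ⟨
    F - κ′ * u ^ 5 * S (suc n) - tail
      ≈⟨ R.+-congʳ (solve 5 (λ f k x z s → f :- k :* x :* s := (f :- k :* z :* x) :+ k :* x :* (z :- s)) R.refl
           F κ′ (u ^ 5) (ζ 10) (S (suc n))) ⟩
    (F - κ′ * ζ 10 * u ^ 5) + κ′ * u ^ 5 * (ζ 10 - S (suc n)) - tail
      ≈⟨ R.+-congʳ (R.+-congʳ (R.+-congˡ (R.-‿cong (R.*-congʳ κ′ζ≈κ)))) ⟩
    (F - κ * u ^ 5) + κ′ * u ^ 5 * (ζ 10 - S (suc n)) - tail ∎
    where
    open SetoidReasoning R.setoid
    F tail : Carrier
    F = fromℕ (# ℰ̃ ⟨ u ^ 6 ⟩)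
    tail = (∑< n) (λ d → error (shrink (suc d) u))
    term : ∀ d → fromℕ (#ℰ (shrink d u)) ≈ error (shrink d u) + κ′ * u ^ 5 * ζ-term 10 d
    term d = begin
      fromℕ (#ℰ (shrink d u))
        ≈⟨ -+-cancel _ _ ⟨
      error (shrink d u) + κ′ * shrink d u ^ 5
        ≈⟨ R.+-congˡ (R.*-congˡ (shrink-^ d u 5)) ⟩
      error (shrink d u) + κ′ * (u ^ 5 * recip d ^ 10)
        ≈⟨ R.+-congˡ (R.*-assoc κ′ _ _) ⟨
      error (shrink d u) + κ′ * u ^ 5 * recip d ^ 10
        ≈⟨ R.+-congˡ (R.*-congˡ (Inv.^-⁻¹ d 10)) ⟨
      error (shrink d u) + κ′ * u ^ 5 * ζ-term 10 d ∎
    shrink-0 : shrink 0 u ≈ u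
    shrink-0 = R.trans (R.*-congˡ (R.trans (E.^-congˡ 2 recip-0) (1^n 2))) (R.*-identityʳ u)
    F≈ : F ≈ error u + tail + κ′ * u ^ 5 * S (suc n)
    F≈ = begin
      F
        ≈⟨ ℰ̃-decomposition 0≤u (suc n) large ⟩
      (∑< suc n) (λ d → fromℕ (#ℰ (shrink d u)))
        ≈⟨ ∑-cong (suc n) term ⟩
      (∑< suc n) (λ d → error (shrink d u) + κ′ * u ^ 5 * ζ-term 10 d)
        ≈⟨ ∑-+ (suc n) (λ d → error (shrink d u)) (λ d → κ′ * u ^ 5 * ζ-term 10 d) ⟩
      (∑< suc n) (λ d → error (shrink d u)) + (∑< suc n) (λ d → κ′ * u ^ 5 * ζ-term 10 d)
        ≈⟨ R.+-cong (∑-head n (λ d → error (shrink d u))) (∑-*ˡ (suc n) (κ′ * u ^ 5) (ζ-term 10)) ⟩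
      error (shrink 0 u) + tail + κ′ * u ^ 5 * S (suc n)
        ≈⟨ R.+-congʳ (R.+-congʳ (error-cong shrink-0)) ⟩
      error u + tail + κ′ * u ^ 5 * S (suc n) ∎

  error-step : ∀ {u} → 1# ≤ u →
    (∀ d → Within (error (shrink (suc d) u)) (K * shrink (suc d) u ^ 3)) →
    Within (error u) (K * u ^ 3)
  error-step {u} 1≤u ih = within-resp (R.sym (error-recursion n 0≤u large)) R.refl
    (within-weaken total (within-+ (within-+ (ℰ̃-bound 1≤u R.refl) tail-small) (within-neg (within-∑ n ih))))
    where
    0≤u : 0# ≤ u
    0≤u = O.trans 0≤1 1≤u
    q = κ′ * u ^ 5
    0≤q : 0# ≤ q
    0≤q = *-nonneg 0≤κ′ (^-nonneg 5 0≤u)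
    0<1+q : 0# < 1# + q
    0<1+q = 1≤⇒0< (≤-resp (R.+-identityʳ 1#) R.refl (+-monoʳ-≤ 1# 0≤q))
    -- Chosen to make q · ε ≤ 1; the summand 1 keeps the denominator visibly positive.
    ε = 1# / (1# + q)
    lim = ζ-Convergence.limit 8 ε (0</ 0<1 0<1+q)
    arch = archimedean (u ^ 2 + u ^ 3)
    -- The sum of both thresholds exceeds each: the one past which the zeta tail is below ε, and the
    -- one past which the decomposition is complete.
    n = proj₁ lim ℕ.+ proj₁ arch
    large : u ^ 2 + u ^ 3 < fromℕ (suc (suc n))
    large = <-≤-trans (proj₂ arch) (fromℕ-mono (ℕ.≤-trans (ℕ.m≤n+m (proj₁ arch) (proj₁ lim)) (ℕ.m≤n+m n 2)))
    0≤ζ-S : 0# ≤ ζ 10 - S (suc n)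
    0≤ζ-S = 0≤y-x (ζ-Convergence.S≤z 8 (suc n))
    ζ-S≤ε : ζ 10 - S (suc n) ≤ ε
    ζ-S≤ε = O.trans (≤-resp (solve 2 (λ s z → :- (s :- z) := z :- s) R.refl (S (suc n)) (ζ 10)) R.refl (MX.x≤y⊔x _ _))
      (proj₁ (proj₂ lim (suc n) (ℕ.m≤n⇒m≤1+n (ℕ.m≤m+n (proj₁ lim) (proj₁ arch)))))
    tail-small : Within (q * (ζ 10 - S (suc n))) (u ^ 3)
    tail-small = within-nonneg (*-nonneg 0≤q 0≤ζ-S) (begin
      q * (ζ 10 - S (suc n))    ≤⟨ *-monoˡ-≤ 0≤q ζ-S≤ε ⟩
      q * ε                     ≤⟨ *-monoʳ-≤ (proj₁ (0</ 0<1 0<1+q)) (≤-resp (R.+-identityˡ q) R.refl (+-mono-≤ 0≤1 O.refl)) ⟩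
      (1# + q) * ε              ≈⟨ *-/-cancel 1# 0<1+q ⟩
      1#                        ≤⟨ 1≤^ 3 1≤u ⟩
      u ^ 3                     ∎)
      where open ≤-Reasoning
    total : fromℕ 10 * u ^ 3 + u ^ 3 + (∑< n) (λ d → K * shrink (suc d) u ^ 3) ≤ K * u ^ 3
    total = begin
      fromℕ 10 * u ^ 3 + u ^ 3 + (∑< n) (λ d → K * shrink (suc d) u ^ 3)
        ≈⟨ R.+-congˡ (R.trans (∑-cong n (λ d → R.trans (R.*-congˡ (shrink-^ (suc d) u 3)) (R.sym (R.*-assoc _ _ _))))
             (∑-*ˡ n (K * u ^ 3) (λ d → recip (suc d) ^ 6))) ⟩
      fromℕ 10 * u ^ 3 + u ^ 3 + K * u ^ 3 * (∑< n) (λ d → recip (suc d) ^ 6)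
        ≤⟨ +-monoʳ-≤ _ (*-monoˡ-≤ (*-nonneg 0≤K (^-nonneg 3 0≤u)) (∑-recip⁶≤half n)) ⟩
      fromℕ 10 * u ^ 3 + u ^ 3 + K * u ^ 3 * half
        ≈⟨ solve 3 (λ s k h → con (+ 10) :* s :+ s :+ con (+ 2) :* (con (+ 11) :+ k) :* s :* h
             := con (+ 11) :* s :+ (con (+ 11) :+ k) :* s :* (con (+ 2) :* h)) R.refl (u ^ 3) κ′ half ⟩
      fromℕ 11 * u ^ 3 + (fromℕ 11 + κ′) * u ^ 3 * (fromℕ 2 * half)
        ≈⟨ R.+-congˡ (R.trans (R.*-congˡ (Inv.inverse 1)) (R.*-identityʳ _)) ⟩
      fromℕ 11 * u ^ 3 + (fromℕ 11 + κ′) * u ^ 3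
        ≤⟨ +-mono-≤ (*-monoʳ-≤ (^-nonneg 3 0≤u) (≤-resp (R.+-identityʳ _) R.refl (+-monoʳ-≤ (fromℕ 11) 0≤κ′))) O.refl ⟩
      (fromℕ 11 + κ′) * u ^ 3 + (fromℕ 11 + κ′) * u ^ 3
        ≈⟨ solve 2 (λ s k → k :* s :+ k :* s := con (+ 2) :* k :* s) R.refl (u ^ 3) (fromℕ 11 + κ′) ⟩
      K * u ^ 3 ∎
      where open ≤-Reasoning

  -- No curve is counted, so the error is -κ′u⁵, and u⁵ ≤ u³ below 1.
  error-small : ∀ {u} → 0# ≤ u → u < 1# → Within (error u) (K * u ^ 3)
  error-small {u} 0≤u u<1 = within-resp
    (R.trans (R.sym (R.+-identityˡ _)) (R.+-congʳ (R.reflexive (≡.cong fromℕ (≡.sym (#ℰ-small 0≤u u<1)))))) R.refl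
    (within-neg (within-nonneg (*-nonneg 0≤κ′ (^-nonneg 5 0≤u)) (begin
      κ′ * u ^ 5          ≈⟨ R.*-congˡ (E.^-homo-* u 3 2) ⟩
      κ′ * (u ^ 3 * u ^ 2) ≤⟨ *-mono-≤ 0≤κ′ (*-nonneg (^-nonneg 3 0≤u) 0≤1) κ′≤K
                               (*-monoˡ-≤ (^-nonneg 3 0≤u) (^≤1 2 0≤u (proj₁ u<1))) ⟩
      K * (u ^ 3 * 1#)    ≈⟨ R.*-congˡ (R.*-identityʳ _) ⟩
      K * u ^ 3           ∎)))
    where
    open ≤-Reasoning
    κ′≤K : κ′ ≤ K
    κ′≤K = ≤-resp (R.+-identityˡ κ′) (solve 1 (λ k → con (+ 22) :+ k :+ k := con (+ 2) :* (con (+ 11) :+ k)) R.refl κ′)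
      (+-mono-≤ (+-nonneg (0≤fromℕ 22) 0≤κ′) O.refl)

  -- The induction runs over an integer above u, since the real argument itself offers none. K stays
  -- the same at every level, so the depth of the descent does not enter the bound.
  error-bound : ∀ n {u} → 0# ≤ u → u < fromℕ (suc n) → Within (error u) (K * u ^ 3)
  error-bound zero    0≤u u<1 = error-small 0≤u (<-resp R.refl (R.+-identityʳ 1#) u<1)
  error-bound (suc n) {u} 0≤u u<2+n = [ (λ 1≤u → error-step 1≤u λ d →
      error-bound n (shrink-nonneg (suc d) 0≤u) (shrink-suc< d n 0≤u u<2+n)) , error-small 0≤u ]′ (≤⊎> 1# u)

  ℰ-asymptotic : ∀ {X} → 0# ≤ X → Within (fromℕ (# ℰ ⟨ X ⟩) - κ′ * X ^[ 5 / 6 ]) (K * X ^[ 1 / 2 ])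
  ℰ-asymptotic {X} 0≤X = within-resp
    (R.+-cong (R.reflexive (≡.cong fromℕ (#-cong ℰ u⁶≈X))) (R.-‿cong (R.*-congˡ (E.^-congˡ 5 (x^1≈x _)))))
    (R.*-congˡ (R.sym w≈u³))
    (error-bound (proj₁ (archimedean u)) 0≤u (<-≤-trans (proj₂ (archimedean u)) (fromℕ-mono (ℕ.n≤1+n (proj₁ (archimedean u))))))
    where open Exact 0≤X

theorem2p1 : (em : ExcludedMiddle 0ℓ) (ℝ : CompleteOrderedField) → let open Reals em ℝ in
    (α β : Carrier) (1≤α : 1# ≤ α) (1≤β : 1# ≤ β) → let open Counting em ℝ α β 1≤α 1≤β in
    (λ X → fromℕ (# ℰ ⟨ X ⟩))
    ≈ (λ X → fromℕ 4 / (α ^[ 1 / 3 ] * β ^[ 1 / 2 ] * ζ 10) * X ^[ 5 / 6 ])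
    +O (λ X → X ^[ 1 / 2 ])
    × (∀ X → 1# < X →
    + (# ℰ̃ ⟨ X ⟩)
    ≡ (+ 2 ℤ.* ⌊ X ^[ 1 / 3 ] / α ^[ 1 / 3 ] ⌋ ℤ.+ + 1)
    ℤ.* (+ 2 ℤ.* ⌊ X ^[ 1 / 2 ] / β ^[ 1 / 2 ] ⌋ ℤ.+ + 1)
    ℤ.- + 2 ℤ.* ⌊ c * X ^[ 1 / 6 ] ⌋ ℤ.- + 1)
    × (λ X → fromℕ (# ℰ̃ ⟨ X ⟩))
    ≈ (λ X → fromℕ 4 / (α ^[ 1 / 3 ] * β ^[ 1 / 2 ]) * X ^[ 5 / 6 ])
    +O (λ X → X ^[ 1 / 2 ])
theorem2p1 em ℝ α β 1≤α 1≤β =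
  (K , λ X 1<X → within⇒∣∣≤ (ℰ-asymptotic (0≤X 1<X))) ,
  (λ X 1<X → Exact.formula (0≤X 1<X)) ,
  (fromℕ 10 , λ X 1<X → within⇒∣∣≤ (ℰ̃-asymptotic (0≤X 1<X) (proj₁ 1<X)))
  where
  open RealAlgebra em ℝ
  open Counting em ℝ α β 1≤α 1≤β
  open Asymptotics em ℝ α β 1≤α 1≤β
  0≤X : ∀ {X} → 1# < X → 0# ≤ X
  0≤X 1<X = O.trans 0≤1 (proj₁ 1<X)
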